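{- Let $n>0$. Then $(\mathcal{W}(S_n),\leqslant)$ is graded, of rank ${n \choose 2}-{\lfloor \frac{n}{2}\rfloor \choose 2}$, and its rank function is $\ell_{\mathcal{W}}$.
   Context: For $n\in\mathbb{P}$, let $S_n$ be the symmetric group with Bruhat order $\leqslant$ and length $\ell(\sigma)=|\{(i,j):i<j,\ \sigma(i)>\sigma(j)\}|$ (number of inversions). Define the involution on $[n]$: $i^*=i-1$ if $i$ is even; $i^*=i+1$ if $i$ is odd and $i+1\in[n]$; $i^*=n$ otherwise. The set of Wachs permutations is $\mathcal{W}(S_n)=\{\sigma\in S_n: |\sigma^{ -1}(i)-\sigma^{ -1}(i^*)|\leq 1 \text{ for all } i\in[n-1]\}$, with the order induced by Bruhat order. Let $m=\lfloor n/2\rfloor$. Define $f_n:\mathcal{W}(S_n)\to S_m$ as follows: if $n=2m$ and $v\in\mathcal{W}(S_{2m})$, then for each $i\in[m]$ one has $\{v(2i-1),v(2i)\}=\{2\tau(i)-1,2\tau(i)\}$ for a unique $\tau\in S_m$, and $f_n(v)=\tau$; if $n=2m+1$, let $\chi_n(v)\in\mathcal{W}(S_{2m})$ be the word obtained from $v$ by deleting the letter $n$, and set $f_n(v)=f_{2m}(\chi_n(v))$. Finally $\ell_{\mathcal{W}}(v):=\ell(v)-\ell(f_n(v))$ for all $v\in\mathcal{W}(S_n)$. -}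

module Defs where

open import Data.Nat using (ℕ; zero; suc; _+_; _∸_; _≤_; _<_; _<?_; _≟_; ⌈_/2⌉; ⌊_/2⌋; ∣_-_∣)
open import Data.Nat.Combinatorics using (_C_)
open import Data.Fin using (Fin; toℕ)
open import Data.Vec using (Vec; lookup; toList; map; _[_]≔_)
open import Data.List using (List; []; _∷_; length; filter)
open import Data.Bool using (Bool; true; false; if_then_else_)
open import Data.Product using (Σ; ∃; _×_; _,_; proj₁)
open import Relation.Nullary using (¬_; ¬?; does)
open import Relation.Binary.PropositionalEquality using (_≡_; _≢_)
open import Relation.Binary.Construct.Closure.ReflexiveTransitive using (Star)

-- Permutations of [n] in one-line notation.
-- A word w : Vec (Fin n) n stands for σ with σ(j+1) = toℕ (lookup w j) + 1.

IsPerm : ∀ {n} → Vec (Fin n) n → Set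
IsPerm {n} w = ∀ (i j : Fin n) → lookup w i ≡ lookup w j → i ≡ j

vals : ∀ {n} → Vec (Fin n) n → List ℕ
vals w = toList (map (λ a → suc (toℕ a)) w)

invs : List ℕ → ℕ
invs []       = 0
invs (x ∷ xs) = length (filter (λ y → y <? x) xs) + invs xs

len : ∀ {n} → Vec (Fin n) n → ℕ
len w = invs (vals w)

-- right multiplication by the transposition (i j): swap positions i, j
swap : ∀ {n} → Vec (Fin n) n → Fin n → Fin n → Vec (Fin n) n
swap w i j = (w [ i ]≔ lookup w j) [ j ]≔ lookup w i

BruhatStep : ∀ {n} → Vec (Fin n) n → Vec (Fin n) n → Set
BruhatStep {n} u v = Σ (Fin n) λ i → Σ (Fin n) λ j → (v ≡ swap u i j) × (len u < len v)

Bruhat≤ : ∀ {n} → Vec (Fin n) n → Vec (Fin n) n → Set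
Bruhat≤ = Star BruhatStep

isEven : ℕ → Bool
isEven zero          = true
isEven (suc zero)    = false
isEven (suc (suc k)) = isEven k

star : ℕ → ℕ → ℕ
star n i = if isEven i then i ∸ 1 else (if does (suc i Data.Nat.≤? n) then suc i else n)

-- |σ⁻¹(i) - σ⁻¹(i*)| ≤ 1 for all i ∈ [n-1]:
-- for positions j, k with σ(j) = i ∈ [n-1] and σ(k) = i*, |j - k| ≤ 1.
IsWachs : ∀ {n} → Vec (Fin n) n → Set
IsWachs {n} w = ∀ (j k : Fin n) →
  suc (toℕ (lookup w j)) < n →
  suc (toℕ (lookup w k)) ≡ star n (suc (toℕ (lookup w j))) →
  ∣ toℕ j - toℕ k ∣ ≤ 1

W : ℕ → Set
W n = Σ (Vec (Fin n) n) λ w → IsPerm w × IsWachs w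

_≤W_ : ∀ {n} → W n → W n → Set
u ≤W v = Bruhat≤ (proj₁ u) (proj₁ v)

_<W_ : ∀ {n} → W n → W n → Set
u <W v = (u ≤W v) × (proj₁ u ≢ proj₁ v)

-- τ(i) = ⌈v(2i-1)/2⌉, read off from consecutive pairs of letters
pairBlocks : List ℕ → List ℕ
pairBlocks (a ∷ b ∷ rest) = ⌈ a /2⌉ ∷ pairBlocks rest
pairBlocks _              = []

chi : ℕ → List ℕ → List ℕ
chi n xs = if isEven n then xs else filter (λ x → ¬? (x ≟ n)) xs

fW : ∀ {n} → Vec (Fin n) n → List ℕ
fW {n} v = pairBlocks (chi n (vals v))

lenW : ∀ {n} → W n → ℕ
lenW v = len (proj₁ v) ∸ invs (fW (proj₁ v))

module Graded {A : Set} (_<_ : A → A → Set) where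

  Minimal : A → Set
  Minimal x = ¬ (∃ λ y → y < x)

  Maximal : A → Set
  Maximal x = ¬ (∃ λ y → x < y)

  _⋖_ : A → A → Set
  x ⋖ y = (x < y) × ¬ (∃ λ z → (x < z) × (z < y))

  data Chain : A → A → ℕ → Set where
    single : ∀ x → Chain x x 0
    step   : ∀ {x y z k} → x ⋖ y → Chain y z k → Chain x z (suc k)

  GradedOfRank : ℕ → Set
  GradedOfRank r = ∀ x z k → Chain x z k → Minimal x → Maximal z → k ≡ r

  IsRankFunction : (A → ℕ) → Set
  IsRankFunction ρ = (∀ x → Minimal x → ρ x ≡ 0) × (∀ x y → x ⋖ y → ρ y ≡ suc (ρ x))

{-# OPTIONS --safe #-}
module Submission where

-- Bruhat order is the comparison of the rank matrices cnt w a b = #{x < a : w x < b}.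
-- A Wachs permutation is determined by the order τ ∈ S_m of its blocks {2t, 2t+1} (letters
-- counted from 0), the set of reversed blocks ε, and, for odd n, the number p of blocks in front of the letter n.
-- Rank matrices are determined at even indices by that of τ, so (τ, ε, p) ≤ (τ′, ε′, p′) iff
-- τ ≤ τ′ in Bruhat order, p′ ≤ p, and ε a ≤ ε′ a for each block a which is common to τ and τ′,
-- lies on the same side of n, and around which the rank matrices of τ and τ′ agree.
-- Hence if u < v then some w with u < w ≤ v arises from u by reversing one block, by a covering
-- transposition of two reversed blocks which become unreversed, or by moving n to the left over
-- a reversed block which becomes unreversed. As ℓ_W = 3 inv τ + |ε| + 2(m − p), each of these
-- moves raises ℓ_W by one.

open import Defs
open import Data.Nat
open import Data.Nat.Properties
open import Data.Nat.Combinatorics using (_C_; nC1≡n; nCk+nC[k+1]≡[n+1]C[k+1])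
open import Data.Nat.Tactic.RingSolver using (solve-∀)
open import Data.Bool using (Bool; true; false; not; if_then_else_)
import Data.Bool as Bool
open import Data.Bool.Properties using (not-involutive)
open import Data.Fin using (Fin; toℕ; fromℕ<)
import Data.Fin as Fin
open import Data.Fin.Properties using (toℕ-injective; toℕ<n; toℕ-fromℕ<; fromℕ<-toℕ)
open import Data.Vec using (Vec; []; _∷_; lookup; tabulate; toList; _[_]≔_)
import Data.Vec as Vec
open import Data.Vec.Properties using (lookup∘tabulate; lookup∘update; lookup∘update′; tabulate∘lookup; tabulate-cong; ≡-dec)
open import Data.List using ([]; _∷_; length; filter; applyUpTo)
open import Data.List.Properties using (filter-accept; filter-reject)
open import Data.Product using (Σ; ∃; _×_; _,_; proj₁; proj₂)
open import Data.Sum using (_⊎_; inj₁; inj₂)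
open import Data.Empty using (⊥; ⊥-elim)
open import Function using (_∘_)
open import Relation.Nullary using (¬_; Dec; yes; no; contradiction; ¬?; _×-dec_)
open import Relation.Nullary.Decidable using (dec-true)
open import Relation.Binary.Definitions using (tri<; tri≈; tri>)
open import Relation.Binary.PropositionalEquality
open import Relation.Binary.Construct.Closure.ReflexiveTransitive using (_◅_) renaming (ε to done)

-- Counting and inversions

-- The obstacle is that the order does not compare ε block by block. In the rank matrix of a block
-- word everything is forced by τ except the centre of a 2×2 cell that carries a dot of τ, where an
-- unreversed block counts one more. A strict gap between the matrices of τ and τ′ at that place
-- already pays for this unit. This decides which move is possible. A covering transposition of τ
-- towards τ′ concerns two unconstrained blocks: block i holds different letters in τ and τ′, and
-- block j, if it is common to both, shows a gap. An unreversed one among them may therefore be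
-- reversed, which gains 1. If both are reversed, the swap gains 4 inversions, of which f_n takes
-- back 1, and unreversing both blocks loses 2. In the same way the letter n gains 2 by passing a
-- block and loses 1 by unreversing it.

ind : ℕ → ℕ → ℕ
ind _       zero    = 0
ind zero    (suc _) = 1
ind (suc x) (suc y) = ind x y

ind-< : ∀ {x y} → x < y → ind x y ≡ 1
ind-< {zero}  {suc y} _       = refl
ind-< {suc x} {suc y} (s≤s p) = ind-< p

ind-≥ : ∀ {x y} → y ≤ x → ind x y ≡ 0
ind-≥ {x}     {zero}  _       = refl
ind-≥ {suc x} {suc y} (s≤s p) = ind-≥ p

ind≤1 : ∀ x y → ind x y ≤ 1
ind≤1 x       zero    = z≤n
ind≤1 zero    (suc y) = s≤s z≤n
ind≤1 (suc x) (suc y) = ind≤1 x y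

ind-monoʳ : ∀ x {y z} → y ≤ z → ind x y ≤ ind x z
ind-monoʳ x       z≤n     = z≤n
ind-monoʳ zero    (s≤s p) = s≤s z≤n
ind-monoʳ (suc x) (s≤s p) = ind-monoʳ x p

ind-step : ∀ x b → ind x (suc b) ≤ suc (ind x b)
ind-step x b = ≤-trans (ind≤1 x (suc b)) (s≤s z≤n)

ind-suc-≢ : ∀ {x b} → x ≢ b → ind x (suc b) ≡ ind x b
ind-suc-≢ {x} {b} x≢b with <-≤-connex x b
... | inj₁ x<b = trans (ind-< (m<n⇒m<1+n x<b)) (sym (ind-< x<b))
... | inj₂ b≤x = trans (ind-≥ (≤∧≢⇒< b≤x (x≢b ∘ sym))) (sym (ind-≥ b≤x))

cnt : (ℕ → ℕ) → ℕ → ℕ → ℕ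
cnt w zero    b = 0
cnt w (suc a) b = cnt w a b + ind (w a) b

gt : (ℕ → ℕ) → ℕ → ℕ → ℕ
gt w zero    b = 0
gt w (suc a) b = gt w a b + ind b (w a)

inv : (ℕ → ℕ) → ℕ → ℕ
inv w zero    = 0
inv w (suc a) = inv w a + gt w a (w a)

cnt-cong : ∀ {u v} a b → (∀ x → x < a → u x ≡ v x) → cnt u a b ≡ cnt v a b
cnt-cong zero    b e = refl
cnt-cong (suc a) b e =
  cong₂ (λ c z → c + ind z b) (cnt-cong a b (λ x p → e x (m<n⇒m<1+n p))) (e a ≤-refl)

gt-cong : ∀ {u v} a b → (∀ x → x < a → u x ≡ v x) → gt u a b ≡ gt v a b
gt-cong zero    b e = refl
gt-cong (suc a) b e =
  cong₂ (λ c z → c + ind b z) (gt-cong a b (λ x p → e x (m<n⇒m<1+n p))) (e a ≤-refl)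

inv-cong : ∀ {u v} a → (∀ x → x < a → u x ≡ v x) → inv u a ≡ inv v a
inv-cong zero    e = refl
inv-cong {u} {v} (suc a) e =
  cong₂ _+_ (inv-cong a e′) (trans (gt-cong a (u a) e′) (cong (gt v a) (e a ≤-refl)))
  where
  e′ : ∀ x → x < a → u x ≡ v x
  e′ x p = e x (m<n⇒m<1+n p)

cnt≤ : ∀ w a b → cnt w a b ≤ a
cnt≤ w zero    b = z≤n
cnt≤ w (suc a) b = ≤-trans (+-mono-≤ (cnt≤ w a b) (ind≤1 (w a) b)) (≤-reflexive (+-comm a 1))

gt≤ : ∀ w a b → gt w a b ≤ a
gt≤ w zero    b = z≤n
gt≤ w (suc a) b = ≤-trans (+-mono-≤ (gt≤ w a b) (ind≤1 b (w a))) (≤-reflexive (+-comm a 1))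

inv≤ : ∀ w a n → a ≤ n → inv w a ≤ a * n
inv≤ w zero    n p = z≤n
inv≤ w (suc a) n p = ≤-trans
  (+-mono-≤ (inv≤ w a n (<⇒≤ p)) (≤-trans (gt≤ w a (w a)) (<⇒≤ p)))
  (≤-reflexive (+-comm (a * n) n))

cnt-full : ∀ w a b → (∀ x → x < a → w x < b) → cnt w a b ≡ a
cnt-full w zero    b h = refl
cnt-full w (suc a) b h = trans
  (cong₂ _+_ (cnt-full w a b (λ x p → h x (m<n⇒m<1+n p))) (ind-< (h a ≤-refl)))
  (+-comm a 1)

cnt-monoʳ : ∀ w a {b c} → b ≤ c → cnt w a b ≤ cnt w a c
cnt-monoʳ w zero    p = z≤n
cnt-monoʳ w (suc a) p = +-mono-≤ (cnt-monoʳ w a p) (ind-monoʳ (w a) p)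

cnt-suc-≢ : ∀ w a b → (∀ x → x < a → w x ≢ b) → cnt w a (suc b) ≡ cnt w a b
cnt-suc-≢ w zero    b h = refl
cnt-suc-≢ w (suc a) b h =
  cong₂ _+_ (cnt-suc-≢ w a b (λ x p → h x (m<n⇒m<1+n p))) (ind-suc-≢ (h a ≤-refl))

Inj< : ℕ → (ℕ → ℕ) → Set
Inj< n w = ∀ x y → x < n → y < n → w x ≡ w y → x ≡ y

cnt-suc≤ : ∀ {n} w a b → a ≤ n → Inj< n w → cnt w a (suc b) ≤ suc (cnt w a b)
cnt-suc≤ w zero    b a≤n inj = z≤n
cnt-suc≤ w (suc a) b a≤n inj with w a ≟ b
... | yes wa≡b = ≤-trans
  (≤-reflexive (cong (_+ ind (w a) (suc b)) (cnt-suc-≢ w a b λ x x<a wx≡b →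
    <⇒≢ x<a (inj x a (<-trans x<a a≤n) a≤n (trans wx≡b (sym wa≡b))))))
  (≤-trans (+-monoʳ-≤ (cnt w a b) (ind-step (w a) b)) (≤-reflexive (+-suc (cnt w a b) _)))
... | no  wa≢b =
  +-mono-≤ (cnt-suc≤ w a b (<⇒≤ a≤n) inj) (≤-reflexive (ind-suc-≢ wa≢b))

cnt-+≤ : ∀ {n} w a b d → a ≤ n → Inj< n w → cnt w a (d + b) ≤ d + cnt w a b
cnt-+≤ w a b zero    a≤n inj = ≤-refl
cnt-+≤ w a b (suc d) a≤n inj =
  ≤-trans (cnt-suc≤ w a (d + b) a≤n inj) (s≤s (cnt-+≤ w a b d a≤n inj))

cnt-zero : ∀ w a → cnt w a 0 ≡ 0
cnt-zero w zero    = refl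
cnt-zero w (suc a) = trans (+-identityʳ _) (cnt-zero w a)

cnt≤ʳ : ∀ {n} w a b → a ≤ n → Inj< n w → cnt w a b ≤ b
cnt≤ʳ w a b a≤n inj = begin
  cnt w a b       ≡⟨ cong (cnt w a) (sym (+-identityʳ b)) ⟩
  cnt w a (b + 0) ≤⟨ cnt-+≤ w a 0 b a≤n inj ⟩
  b + cnt w a 0   ≡⟨ cong (b +_) (cnt-zero w a) ⟩
  b + 0           ≡⟨ +-identityʳ b ⟩
  b               ∎
  where open ≤-Reasoning

record Perm (n : ℕ) (w : ℕ → ℕ) : Set where
  field
    bound : ∀ x → x < n → w x < n
    inj   : Inj< n w
open Perm public

least : ∀ {P : ℕ → Set} → (∀ x → Dec (P x)) → ∀ n →
  (∀ x → x < n → ¬ P x) ⊎ ∃ λ j → j < n × P j × (∀ k → k < j → ¬ P k)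
least P? zero    = inj₁ λ x ()
least {P} P? (suc n) with least P? n
... | inj₂ (j , j<n , pj , min) = inj₂ (j , m<n⇒m<1+n j<n , pj , min)
... | inj₁ none with P? n
...   | yes pn = inj₂ (n , ≤-refl , pn , none)
...   | no ¬pn = inj₁ λ x x≤n → case-≤ x (m≤n⇒m<n∨m≡n (s≤s⁻¹ x≤n))
  where
  case-≤ : ∀ x → x < n ⊎ x ≡ n → ¬ P x
  case-≤ x (inj₁ x<n) = none x x<n
  case-≤ x (inj₂ refl) = ¬pn

-- Pigeonhole by counting: moving one column to the right adds at most one letter, and moving past a
-- missed value y adds none, so at most n - 1 letters would lie below n.
surjective : ∀ {n w} → Perm n w → ∀ y → y < n → ∃ λ x → x < n × w x ≡ y
surjective {n} {w} π y y<n with least (λ x → w x ≟ y) n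
... | inj₂ (x , x<n , e , _) = x , x<n , e
... | inj₁ none = contradiction n≤ (<⇒≱ (≤-reflexive eq))
  where
  d : ℕ
  d = n ∸ suc y
  eq : suc (d + y) ≡ n
  eq = trans (sym (+-suc d y)) (m∸n+n≡m y<n)
  n≤ : n ≤ d + y
  n≤ = begin
    n                     ≡⟨ sym (cnt-full w n n (bound π)) ⟩
    cnt w n n             ≡⟨ cong (cnt w n) (sym (m∸n+n≡m y<n)) ⟩
    cnt w n (d + suc y)   ≤⟨ cnt-+≤ w n (suc y) d ≤-refl (inj π) ⟩
    d + cnt w n (suc y)   ≡⟨ cong (d +_) (cnt-suc-≢ w n y none) ⟩
    d + cnt w n y         ≤⟨ +-monoʳ-≤ d (cnt≤ʳ w n y ≤-refl (inj π)) ⟩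
    d + y                 ∎
    where open ≤-Reasoning

-- Swapping two values and its effect on counts

sw : (ℕ → ℕ) → ℕ → ℕ → ℕ → ℕ
sw u i j x with x ≟ i
... | yes _ = u j
... | no _ with x ≟ j
...   | yes _ = u i
...   | no _  = u x

sw-i : ∀ u i j → sw u i j i ≡ u j
sw-i u i j with i ≟ i
... | yes _ = refl
... | no ¬p = contradiction refl ¬p

sw-j : ∀ u i j → sw u i j j ≡ u i
sw-j u i j with j ≟ i
... | yes e = cong u e
... | no _ with j ≟ j
...   | yes _ = refl
...   | no ¬p = contradiction refl ¬p

sw-other : ∀ u {i j x} → x ≢ i → x ≢ j → sw u i j x ≡ u x
sw-other u {i} {j} {x} p q with x ≟ i
... | yes e = contradiction e p
... | no _ with x ≟ j
...   | yes e = contradiction e q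
...   | no _  = refl

sw-perm : ∀ {n u i j} → i < n → j < n → Perm n u → Perm n (sw u i j)
sw-perm {n} {u} {i} {j} i<n j<n π = record { bound = bd ; inj = λ x y p q e → begin
    x               ≡⟨ sym (σσ x) ⟩
    σ (σ x)         ≡⟨ cong σ (inj π (σ x) (σ y) (σ< x p) (σ< y q)
                        (trans (uσ x) (trans e (sym (uσ y))))) ⟩
    σ (σ y)         ≡⟨ σσ y ⟩
    y               ∎ }
  where
  open ≡-Reasoning
  σ : ℕ → ℕ
  σ = sw (λ z → z) i j
  uσ : ∀ x → u (σ x) ≡ sw u i j x
  uσ x with x ≟ i
  ... | yes _ = refl
  ... | no _ with x ≟ j
  ...   | yes _ = refl
  ...   | no _  = refl
  σσ : ∀ x → σ (σ x) ≡ x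
  σσ x with x ≟ i
  ... | yes e = trans (sw-j (λ z → z) i j) (sym e)
  ... | no p with x ≟ j
  ...   | yes e = trans (sw-i (λ z → z) i j) (sym e)
  ...   | no q  = sw-other (λ z → z) p q
  σ< : ∀ x → x < n → σ x < n
  σ< x p with x ≟ i
  ... | yes _ = j<n
  ... | no _ with x ≟ j
  ...   | yes _ = i<n
  ...   | no _  = p
  bd : ∀ x → x < n → sw u i j x < n
  bd x p = subst (_< n) (uσ x) (bound π (σ x) (σ< x p))

module _ (u : ℕ → ℕ) {i j : ℕ} (i<j : i < j) where

  private
    v = sw u i j

  sw-before : ∀ x → x < i → v x ≡ u x
  sw-before x x<i = sw-other u (<⇒≢ x<i) (<⇒≢ (<-trans x<i i<j))

  sw-mid : ∀ x → i < x → x < j → v x ≡ u x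
  sw-mid x i<x x<j = sw-other u (>⇒≢ i<x) (<⇒≢ x<j)

  sw-after : ∀ x → j < x → v x ≡ u x
  sw-after x j<x = sw-other u (>⇒≢ (<-trans i<j j<x)) (>⇒≢ j<x)

  -- Prefix sums of f over the letters notice a swap only while exactly one of the two positions has
  -- been passed; there `f (u j)` stands in for `f (u i)`. The general F serves `cnt` and `gt`
  -- alike, and adding on both sides avoids truncated subtraction.
  sw-sum : (f : ℕ → ℕ) (F : (ℕ → ℕ) → ℕ → ℕ) →
    (∀ w → F w 0 ≡ 0) → (∀ w a → F w (suc a) ≡ F w a + f (w a)) →
    (∀ a → a ≤ i → F v a ≡ F u a) ×
    (∀ a → i < a → a ≤ j → F v a + f (u i) ≡ F u a + f (u j)) ×
    (∀ a → j < a → F v a ≡ F u a)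
  sw-sum f F F0 Fs = before , mid , after
    where
    open ≡-Reasoning
    step : ∀ a → F v a ≡ F u a → v a ≡ u a → F v (suc a) ≡ F u (suc a)
    step a e e′ = trans (Fs v a) (trans (cong₂ (λ c z → c + f z) e e′) (sym (Fs u a)))
    before : ∀ a → a ≤ i → F v a ≡ F u a
    before zero    p = trans (F0 v) (sym (F0 u))
    before (suc a) p = step a (before a (<⇒≤ p)) (sw-before a p)
    swapʳ : ∀ a b c → a + b + c ≡ a + c + b
    swapʳ = solve-∀
    mid : ∀ a → i < a → a ≤ j → F v a + f (u i) ≡ F u a + f (u j)
    mid (suc a) i≤a a<j with m≤n⇒m<n∨m≡n (s≤s⁻¹ i≤a)
    ... | inj₂ refl = begin
      F v (suc a) + f (u i)     ≡⟨ cong (_+ f (u i)) (Fs v a) ⟩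
      F v a + f (v a) + f (u i) ≡⟨ cong₂ (λ c z → c + f z + f (u i)) (before a ≤-refl) (sw-i u i j) ⟩
      F u a + f (u j) + f (u i) ≡⟨ swapʳ (F u a) _ _ ⟩
      F u a + f (u a) + f (u j) ≡⟨ cong (_+ f (u j)) (sym (Fs u a)) ⟩
      F u (suc a) + f (u j)     ∎
    ... | inj₁ i<a = begin
      F v (suc a) + f (u i)     ≡⟨ cong (_+ f (u i)) (Fs v a) ⟩
      F v a + f (v a) + f (u i) ≡⟨ cong (λ z → F v a + f z + f (u i)) (sw-mid a i<a a<j) ⟩
      F v a + f (u a) + f (u i) ≡⟨ swapʳ (F v a) _ _ ⟩
      F v a + f (u i) + f (u a) ≡⟨ cong (_+ f (u a)) (mid a i<a (<⇒≤ a<j)) ⟩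
      F u a + f (u j) + f (u a) ≡⟨ swapʳ (F u a) _ _ ⟩
      F u a + f (u a) + f (u j) ≡⟨ cong (_+ f (u j)) (sym (Fs u a)) ⟩
      F u (suc a) + f (u j)     ∎
    after : ∀ a → j < a → F v a ≡ F u a
    after (suc a) j≤a with m≤n⇒m<n∨m≡n (s≤s⁻¹ j≤a)
    ... | inj₂ refl = begin
      F v (suc a)     ≡⟨ Fs v a ⟩
      F v a + f (v a) ≡⟨ cong (λ z → F v a + f z) (sw-j u i j) ⟩
      F v a + f (u i) ≡⟨ mid a i<j ≤-refl ⟩
      F u a + f (u j) ≡⟨ sym (Fs u a) ⟩
      F u (suc a)     ∎
    ... | inj₁ j<a = step a (after a j<a) (sw-after a j<a)

  cnt-sw : ∀ b →
    (∀ a → a ≤ i → cnt v a b ≡ cnt u a b) ×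
    (∀ a → i < a → a ≤ j → cnt v a b + ind (u i) b ≡ cnt u a b + ind (u j) b) ×
    (∀ a → j < a → cnt v a b ≡ cnt u a b)
  cnt-sw b = sw-sum (λ z → ind z b) (λ w a → cnt w a b) (λ _ → refl) (λ _ _ → refl)

  gt-sw : ∀ b →
    (∀ a → a ≤ i → gt v a b ≡ gt u a b) ×
    (∀ a → i < a → a ≤ j → gt v a b + ind b (u i) ≡ gt u a b + ind b (u j)) ×
    (∀ a → j < a → gt v a b ≡ gt u a b)
  gt-sw b = sw-sum (λ z → ind b z) (λ w a → gt w a b) (λ _ → refl) (λ _ _ → refl)

-- Transpositions and the rank matrix comparison

module _ {n : ℕ} (u : ℕ → ℕ) {i j : ℕ} (inj-u : Inj< n u)
         (i<j : i < j) (j<n : j < n) (ui<uj : u i < u j) where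

  private
    v = sw u i j
    x = u i
    y = u j

  between : ℕ → ℕ
  between z = ind x z * ind z y

  betweenˡ : ∀ z → z ≢ y → ind x z ≡ ind y z + between z
  betweenˡ z z≢y with <-≤-connex z y
  ... | inj₁ z<y = sym (trans (cong₂ _+_ (ind-≥ (<⇒≤ z<y)) (cong (ind x z *_) (ind-< z<y)))
                              (*-identityʳ _))
  ... | inj₂ y≤z = trans (ind-< (<-≤-trans ui<uj y≤z))
      (sym (cong₂ _+_ (ind-< (≤∧≢⇒< y≤z (z≢y ∘ sym)))
                      (trans (cong (ind x z *_) (ind-≥ y≤z)) (*-zeroʳ (ind x z)))))

  betweenʳ : ∀ z → z ≢ x → ind z y ≡ ind z x + between z
  betweenʳ z z≢x with <-≤-connex x z
  ... | inj₁ x<z = sym (trans (cong₂ _+_ (ind-≥ (<⇒≤ x<z)) (cong (_* ind z y) (ind-< x<z)))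
                              (+-identityʳ _))
  ... | inj₂ z≤x = trans (ind-< (≤-<-trans z≤x ui<uj))
      (sym (cong₂ _+_ (ind-< (≤∧≢⇒< z≤x z≢x)) (cong (_* ind z y) (ind-≥ z≤x))))

  -- The number of k with i < k ≤ i + d and u i < u k < u j.
  bet : ℕ → ℕ
  bet zero    = 0
  bet (suc d) = bet d + between (u (suc (d + i)))

  private
    i<n : i < n
    i<n = <-trans i<j j<n

    i<d : ∀ d → i < suc (d + i)
    i<d d = s≤s (m≤n+m i d)

    u≢y : ∀ k → k < j → u k ≢ y
    u≢y k k<j e = <⇒≢ k<j (inj-u k j (<-trans k<j j<n) j<n e)

    u≢x : ∀ k → i < k → k < j → u k ≢ x
    u≢x k i<k k<j e = >⇒≢ i<k (inj-u k i (<-trans k<j j<n) i<n e)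

  -- From position i onwards, a letter that exceeds x either exceeds y or lies between the two,
  -- since y itself occurs only at j.
  gt-bet : ∀ d → suc (d + i) ≤ j →
    gt u (suc (d + i)) x + gt u i y ≡ gt u i x + gt u (suc (d + i)) y + bet d
  gt-bet zero p
    rewrite ind-≥ {x} {x} ≤-refl | ind-≥ {y} {x} (<⇒≤ ui<uj) = lem (gt u i x) (gt u i y)
    where
    lem : ∀ a b → a + 0 + b ≡ a + (b + 0) + 0
    lem = solve-∀
  gt-bet (suc d) p = begin
    gt u k x + ind x z + gt u i y                          ≡⟨ swapʳ (gt u k x) _ _ ⟩
    gt u k x + gt u i y + ind x z                          ≡⟨ cong₂ _+_ (gt-bet d (<⇒≤ p)) (betweenˡ z (u≢y k p)) ⟩
    gt u i x + gt u k y + bet d + (ind y z + between z)    ≡⟨ lem (gt u i x) _ _ _ _ ⟩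
    gt u i x + (gt u k y + ind y z) + (bet d + between z)  ∎
    where
    open ≡-Reasoning
    k = suc (d + i)
    z = u k
    swapʳ : ∀ a b c → a + b + c ≡ a + c + b
    swapʳ = solve-∀
    lem : ∀ a b c d e → a + b + c + (d + e) ≡ a + (b + d) + (c + e)
    lem = solve-∀

  inv-sw-before : inv v i ≡ inv u i
  inv-sw-before = inv-cong i (sw-before u i<j)

  inv-bet : ∀ d → suc (d + i) ≤ j →
    inv v (suc (d + i)) + gt u i x ≡ inv u (suc (d + i)) + gt u i y + bet d
  inv-bet zero p = begin
    inv v i + gt v i (v i) + gt u i x ≡⟨ cong (λ c → c + gt v i (v i) + gt u i x) inv-sw-before ⟩
    inv u i + gt v i (v i) + gt u i x ≡⟨ cong (λ c → inv u i + c + gt u i x)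
                                           (trans (cong (gt v i) (sw-i u i j)) (proj₁ (gt-sw u i<j y) i ≤-refl)) ⟩
    inv u i + gt u i y + gt u i x     ≡⟨ lem (inv u i) _ _ ⟩
    inv u i + gt u i x + gt u i y + 0 ∎
    where
    open ≡-Reasoning
    lem : ∀ a b c → a + b + c ≡ a + c + b + 0
    lem = solve-∀
  inv-bet (suc d) p = begin
    inv v k + gt v k (v k) + gt u i x           ≡⟨ cong (λ c → inv v k + gt v k c + gt u i x) (sw-mid u i<j k (i<d d) p) ⟩
    inv v k + gt v k z + gt u i x               ≡⟨ swapʳ (inv v k) _ _ ⟩
    inv v k + gt u i x + gt v k z               ≡⟨ cong₂ _+_ (inv-bet d (<⇒≤ p)) gtk ⟩
    inv u k + gt u i y + bet d + (gt u k z + between z) ≡⟨ lem (inv u k) _ _ _ _ ⟩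
    inv u k + gt u k z + gt u i y + (bet d + between z) ∎
    where
    open ≡-Reasoning
    k = suc (d + i)
    z = u k
    swapʳ : ∀ a b c → a + b + c ≡ a + c + b
    swapʳ = solve-∀
    swapᵐ : ∀ a b c → a + (b + c) ≡ a + c + b
    swapᵐ = solve-∀
    lem : ∀ a b c d e → a + b + c + (d + e) ≡ a + d + b + (c + e)
    lem = solve-∀
    gtk : gt v k z ≡ gt u k z + between z
    gtk = +-cancelʳ-≡ (ind z x) _ _ (begin
      gt v k z + ind z x               ≡⟨ proj₁ (proj₂ (gt-sw u i<j z)) k (i<d d) (<⇒≤ p) ⟩
      gt u k z + ind z y               ≡⟨ cong (gt u k z +_) (betweenʳ z (u≢x k (i<d d) p)) ⟩
      gt u k z + (ind z x + between z) ≡⟨ swapᵐ (gt u k z) _ _ ⟩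
      gt u k z + between z + ind z x   ∎)

  private
    D = j ∸ suc i

    D-eq : suc (D + i) ≡ j
    D-eq = trans (sym (+-suc D i)) (m∸n+n≡m i<j)

  bets : ℕ
  bets = bet D

  -- The swapped pair becomes one inversion, and every letter between the two in both position and
  -- value becomes inverted with both of them, whence the factor 2. All other letters exchange
  -- inversions without net change.
  inv-sw-j : inv v (suc j) ≡ suc (inv u (suc j) + 2 * bets)
  inv-sw-j = +-cancelʳ-≡ (gt u i x + gt u i y) _ _ (begin
    inv v j + gt v j (v j) + (gt u i x + gt u i y)       ≡⟨ cong (λ c → inv v j + c + (gt u i x + gt u i y)) gtj ⟩
    inv v j + suc (gt u j x) + (gt u i x + gt u i y)     ≡⟨ lem₁ (inv v j) _ _ _ ⟩
    suc ((inv v j + gt u i x) + (gt u j x + gt u i y))   ≡⟨ cong suc (cong₂ _+_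
         (subst (λ k → inv v k + gt u i x ≡ inv u k + gt u i y + bets) D-eq (inv-bet D (≤-reflexive D-eq)))
         (subst (λ k → gt u k x + gt u i y ≡ gt u i x + gt u k y + bets) D-eq (gt-bet D (≤-reflexive D-eq)))) ⟩
    suc ((inv u j + gt u i y + bets) + (gt u i x + gt u j y + bets)) ≡⟨ lem₂ (inv u j) _ _ _ _ ⟩
    suc (inv u j + gt u j y + 2 * bets) + (gt u i x + gt u i y) ∎)
    where
    open ≡-Reasoning
    lem₁ : ∀ a b c d → a + suc b + (c + d) ≡ suc ((a + c) + (b + d))
    lem₁ = solve-∀
    lem₂ : ∀ a b c d e → suc ((a + b + c) + (d + e + c)) ≡ suc (a + e + 2 * c) + (d + b)
    lem₂ = solve-∀
    gtj : gt v j (v j) ≡ suc (gt u j x)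
    gtj = begin
      gt v j (v j)           ≡⟨ cong (gt v j) (sw-j u i j) ⟩
      gt v j x               ≡⟨ sym (+-identityʳ _) ⟩
      gt v j x + 0           ≡⟨ cong (gt v j x +_) (sym (ind-≥ {x} {x} ≤-refl)) ⟩
      gt v j x + ind x x     ≡⟨ proj₁ (proj₂ (gt-sw u i<j x)) j i<j ≤-refl ⟩
      gt u j x + ind x y     ≡⟨ cong (gt u j x +_) (ind-< ui<uj) ⟩
      gt u j x + 1           ≡⟨ +-comm _ 1 ⟩
      suc (gt u j x)         ∎

  inv-sw-after : ∀ a → j < a → inv v a ≡ suc (inv u a + 2 * bets)
  inv-sw-after (suc a) j≤a with m≤n⇒m<n∨m≡n (s≤s⁻¹ j≤a)
  ... | inj₂ refl = inv-sw-j
  ... | inj₁ j<a  = begin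
    inv v a + gt v a (v a)                  ≡⟨ cong₂ _+_ (inv-sw-after a j<a)
                                                 (trans (cong (gt v a) (sw-after u i<j a j<a)) (proj₂ (proj₂ (gt-sw u i<j (u a))) a j<a)) ⟩
    suc (inv u a + 2 * bets) + gt u a (u a) ≡⟨ lem (inv u a) bets _ ⟩
    suc (inv u a + gt u a (u a) + 2 * bets) ∎
    where
    open ≡-Reasoning
    lem : ∀ a b c → suc (a + 2 * b) + c ≡ suc (a + c + 2 * b)
    lem = solve-∀

  inv-sw-< : inv u n < inv v n
  inv-sw-< = ≤-trans (s≤s (m≤m+n (inv u n) _)) (≤-reflexive (sym (inv-sw-after n j<n)))

  inv-sw-cover : (∀ k → i < k → k < j → u i < u k → u k < u j → ⊥) → inv v n ≡ suc (inv u n)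
  inv-sw-cover empty = trans (inv-sw-after n j<n)
    (cong suc (trans (cong (λ c → inv u n + 2 * c) (bet≡0 D (≤-reflexive D-eq))) (+-identityʳ _)))
    where
    between≡0 : ∀ k → i < k → k < j → between (u k) ≡ 0
    between≡0 k i<k k<j with <-≤-connex x (u k) | <-≤-connex (u k) y
    ... | inj₂ uk≤x | _        = cong (_* ind (u k) y) (ind-≥ uk≤x)
    ... | inj₁ _    | inj₂ y≤uk = trans (cong (ind x (u k) *_) (ind-≥ y≤uk)) (*-zeroʳ (ind x (u k)))
    ... | inj₁ x<uk | inj₁ uk<y = ⊥-elim (empty k i<k k<j x<uk uk<y)
    bet≡0 : ∀ d → suc (d + i) ≤ j → bet d ≡ 0
    bet≡0 zero    p = refl
    bet≡0 (suc d) p = cong₂ _+_ (bet≡0 d (<⇒≤ p)) (between≡0 _ (i<d d) p)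

-- The orientation is reversed: the smaller permutation has its small letters earlier and hence the
-- larger counts.
Dom : ℕ → (ℕ → ℕ) → (ℕ → ℕ) → Set
Dom n u v = ∀ a b → a ≤ n → b ≤ n → cnt v a b ≤ cnt u a b

Dom-refl : ∀ {n u} → Dom n u u
Dom-refl a b _ _ = ≤-refl

Dom-trans : ∀ {n u v w} → Dom n u v → Dom n v w → Dom n u w
Dom-trans d e a b p q = ≤-trans (e a b p q) (d a b p q)

Dom-congˡ : ∀ {n u u′ v} → (∀ x → x < n → u x ≡ u′ x) → Dom n u v → Dom n u′ v
Dom-congˡ {v = v} e d a b p q =
  subst (cnt v a b ≤_) (cnt-cong a b (λ x x<a → e x (<-≤-trans x<a p))) (d a b p q)

Dom-congʳ : ∀ {n u v v′} → (∀ x → x < n → v x ≡ v′ x) → Dom n u v → Dom n u v′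
Dom-congʳ {u = u} e d a b p q =
  subst (_≤ cnt u a b) (cnt-cong a b (λ x x<a → e x (<-≤-trans x<a p))) (d a b p q)

Dom-weaken : ∀ {n k u v} → k ≤ n → Dom n u v → Dom k u v
Dom-weaken k≤n d a b p q = d a b (≤-trans p k≤n) (≤-trans q k≤n)

sw-Dom : ∀ {n} u {i j} → i < j → u i < u j → Dom n u (sw u i j)
sw-Dom u {i} {j} i<j ui<uj a b _ _ with <-≤-connex i a | <-≤-connex j a
... | inj₂ a≤i | _        = ≤-reflexive (proj₁ (cnt-sw u i<j b) a a≤i)
... | inj₁ _   | inj₁ j<a = ≤-reflexive (proj₂ (proj₂ (cnt-sw u i<j b)) a j<a)
... | inj₁ i<a | inj₂ a≤j = +-cancelʳ-≤ (ind (u i) b) _ _ (≤-trans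
  (≤-reflexive (proj₁ (proj₂ (cnt-sw u i<j b)) a i<a a≤j))
  (+-monoʳ-≤ (cnt u a b) ind≤))
  where
  ind≤ : ind (u j) b ≤ ind (u i) b
  ind≤ with <-≤-connex (u j) b
  ... | inj₁ p = ≤-reflexive (trans (ind-< p) (sym (ind-< (<-trans ui<uj p))))
  ... | inj₂ p = ≤-trans (≤-reflexive (ind-≥ p)) z≤n

cnt-sw-outside : ∀ u {i j} → i < j → u i < u j → ∀ a b →
  ¬ (i < a × a ≤ j × u i < b × b ≤ u j) → cnt (sw u i j) a b ≡ cnt u a b
cnt-sw-outside u {i} {j} i<j ui<uj a b out with <-≤-connex i a | <-≤-connex j a
... | inj₂ a≤i | _        = proj₁ (cnt-sw u i<j b) a a≤i
... | inj₁ _   | inj₁ j<a = proj₂ (proj₂ (cnt-sw u i<j b)) a j<a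
... | inj₁ i<a | inj₂ a≤j = +-cancelʳ-≡ (ind (u i) b) _ _
  (trans (proj₁ (proj₂ (cnt-sw u i<j b)) a i<a a≤j) (cong (cnt u a b +_) ind≡))
  where
  ind≡ : ind (u j) b ≡ ind (u i) b
  ind≡ with <-≤-connex (u i) b | <-≤-connex (u j) b
  ... | inj₂ p | _      = trans (ind-≥ (≤-trans p (<⇒≤ ui<uj))) (sym (ind-≥ p))
  ... | inj₁ p | inj₁ q = trans (ind-< q) (sym (ind-< p))
  ... | inj₁ p | inj₂ q = contradiction (i<a , a≤j , p , q) out

cnt-sw-inside : ∀ u {i j} → i < j → ∀ a b →
  i < a → a ≤ j → u i < b → b ≤ u j → suc (cnt (sw u i j) a b) ≡ cnt u a b
cnt-sw-inside u {i} {j} i<j a b i<a a≤j p q = begin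
  suc (cnt v a b)         ≡⟨ +-comm 1 _ ⟩
  cnt v a b + 1           ≡⟨ cong (cnt v a b +_) (sym (ind-< p)) ⟩
  cnt v a b + ind (u i) b ≡⟨ proj₁ (proj₂ (cnt-sw u i<j b)) a i<a a≤j ⟩
  cnt u a b + ind (u j) b ≡⟨ cong (cnt u a b +_) (ind-≥ q) ⟩
  cnt u a b + 0           ≡⟨ +-identityʳ _ ⟩
  cnt u a b               ∎
  where
  open ≡-Reasoning
  v = sw u i j

-- `ui≢vi` and `strict` go beyond a covering step below v: they are the reasons why, in
-- `interpolate`, block i or block j may be reversed instead of swapped.
record CoverSwap (n : ℕ) (u v : ℕ → ℕ) : Set where
  field
    i j   : ℕ
    i<j   : i < j
    j<n   : j < n
    ui<uj : u i < u j
    empty : ∀ k → i < k → k < j → u i < u k → u k < u j → ⊥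
    below : Dom n (sw u i j) v
    ui≢vi : u i ≢ v i
    strict : cnt v j (u j) < cnt u j (u j)

-- Take i the first disagreement of u and v, and j > i least with u i < u j ≤ v i.
coverSwap : ∀ {n u v} → Perm n u → Perm n v → Dom n u v →
  (∀ x → x < n → u x ≡ v x) ⊎ CoverSwap n u v
coverSwap {n} {u} {v} πu πv dom with least (λ x → ¬? (u x ≟ v x)) n
... | inj₁ none = inj₁ λ x x<n → agree x (none x x<n)
  where
  agree : ∀ x → ¬ (u x ≢ v x) → u x ≡ v x
  agree x nn with u x ≟ v x
  ... | yes e = e
  ... | no ne = contradiction ne nn
... | inj₂ (i , i<n , ui≢vi , first) = inj₂ found
  where
  agree : ∀ x → x < i → u x ≡ v x
  agree x x<i with u x ≟ v x
  ... | yes e = e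
  ... | no ne = contradiction ne (first x x<i)

  agree-cnt : ∀ b → cnt u i b ≡ cnt v i b
  agree-cnt b = cnt-cong i b agree

  -- Otherwise row i + 1 would, below v i + 1, count the letter v i but not u i, while the rows
  -- before agree.
  ui<vi : u i < v i
  ui<vi with <-≤-connex (u i) (v i)
  ... | inj₁ p = p
  ... | inj₂ vi≤ui = contradiction
    (dom (suc i) (suc (v i)) i<n (bound πv i i<n))
    (<⇒≱ (≤-reflexive (begin
      suc (cnt u i c + ind (u i) c) ≡⟨ cong (λ z → suc (cnt u i c + z)) (ind-≥ (≤∧≢⇒< vi≤ui (ui≢vi ∘ sym))) ⟩
      suc (cnt u i c + 0)           ≡⟨ cong suc (+-identityʳ _) ⟩
      suc (cnt u i c)               ≡⟨ cong suc (agree-cnt c) ⟩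
      suc (cnt v i c)               ≡⟨ +-comm 1 _ ⟩
      cnt v i c + 1                 ≡⟨ cong (cnt v i c +_) (sym (ind-< {v i} {c} ≤-refl)) ⟩
      cnt v i c + ind (v i) c       ∎)))
    where
    open ≡-Reasoning
    c = suc (v i)

  Good : ℕ → Set
  Good x = i < x × u i < u x × u x ≤ v i

  candidate : ∃ λ x → x < n × Good x
  candidate with surjective πu (v i) (bound πv i i<n)
  ... | x , x<n , e = x , x<n , i<x , subst (u i <_) (sym e) ui<vi , ≤-reflexive e
    where
    i<x : i < x
    i<x with <-cmp i x
    ... | tri< p _ _ = p
    ... | tri≈ _ refl _ = contradiction e ui≢vi
    ... | tri> _ _ x<i = contradiction (inj πv x i x<n i<n (trans (sym (agree x x<i)) e)) (<⇒≢ x<i)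

  found : CoverSwap n u v
  found with least (λ x → i <? x ×-dec u i <? u x ×-dec u x ≤? v i) n
  ... | inj₁ none = contradiction (proj₂ (proj₂ candidate)) (none (proj₁ candidate) (proj₁ (proj₂ candidate)))
  ... | inj₂ (j , j<n , (i<j , ui<uj , uj≤vi) , min) = record
    { i = i ; j = j ; i<j = i<j ; j<n = j<n ; ui<uj = ui<uj
    ; empty = λ k i<k k<j p q → min k k<j (i<k , p , <⇒≤ (<-≤-trans q uj≤vi))
    ; below = below′
    ; ui≢vi = ui≢vi
    ; strict = rect j (u j) i<j ≤-refl ui<uj ≤-refl
    }
    where
    c = suc (v i)

    swap4 : ∀ a b c d → (a + b) + suc (c + d) ≡ (a + suc c) + (b + d)
    swap4 = solve-∀

    swap4′ : ∀ a b c d → (a + b) + (c + d) ≡ (a + c) + (b + d)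
    swap4′ = solve-∀

    -- Compare the letters from b to v i in the first a rows. Before row i both words have equally
    -- many; at row i only v has one, namely v i; in the later rows u has none, by minimality of j.
    -- So v is ahead by at least one, and the comparison in column v i + 1 turns this into a gap in
    -- column b.
    excess : ∀ a b → i < a → a ≤ j → u i < b → b ≤ u j →
      cnt u a c + suc (cnt v a b) ≤ cnt v a c + cnt u a b
    excess (suc a) b i≤a a<j p q with m≤n⇒m<n∨m≡n (s≤s⁻¹ i≤a)
    ... | inj₂ refl = ≤-reflexive (trans
      (cong₂ (λ s t → cnt u a c + s + suc (cnt v a b + t))
        (ind-< (m<n⇒m<1+n ui<vi)) (ind-≥ (≤-trans q uj≤vi)))
      (trans (lem (cnt u a c) (cnt v a b))
      (trans (cong₂ (λ s t → s + 1 + (t + 1)) (agree-cnt c) (sym (agree-cnt b)))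
      (sym (cong₂ (λ s t → cnt v a c + s + (cnt u a b + t)) (ind-< {v a} {c} ≤-refl) (ind-< p))))))
      where
      lem : ∀ a b → a + 1 + suc (b + 0) ≡ a + 1 + (b + 1)
      lem = solve-∀
    ... | inj₁ i<a = begin
      (cnt u a c + ind (u a) c) + suc (cnt v a b + ind (v a) b) ≡⟨ swap4 (cnt u a c) _ _ _ ⟩
      (cnt u a c + suc (cnt v a b)) + (ind (u a) c + ind (v a) b) ≤⟨ +-mono-≤ (excess a b i<a (<⇒≤ a<j) p q) ind≤ ⟩
      (cnt v a c + cnt u a b) + (ind (v a) c + ind (u a) b)     ≡⟨ swap4′ (cnt v a c) _ _ _ ⟩
      (cnt v a c + ind (v a) c) + (cnt u a b + ind (u a) b)     ∎
      where
      open ≤-Reasoning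
      indu : ind (u a) c ≤ ind (u a) b
      indu with <-≤-connex (u a) b
      ... | inj₁ r = ≤-trans (ind≤1 (u a) c) (≤-reflexive (sym (ind-< r)))
      ... | inj₂ r with <-≤-connex (v i) (u a)
      ...   | inj₁ s = ≤-trans (≤-reflexive (ind-≥ s)) z≤n
      ...   | inj₂ s = contradiction (i<a , <-≤-trans p r , s) (min a a<j)
      ind≤ : ind (u a) c + ind (v a) b ≤ ind (v a) c + ind (u a) b
      ind≤ = ≤-trans (+-mono-≤ indu (ind-monoʳ (v a) (≤-trans q (≤-trans uj≤vi (n≤1+n _)))))
                     (≤-reflexive (+-comm (ind (u a) b) _))

    rect : ∀ a b → i < a → a ≤ j → u i < b → b ≤ u j → cnt v a b < cnt u a b
    rect a b i<a a≤j p q = +-cancelˡ-≤ (cnt u a c) _ _ (≤-trans (excess a b i<a a≤j p q)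
      (+-monoˡ-≤ (cnt u a b) (dom a c (≤-trans a≤j (<⇒≤ j<n)) (bound πv i i<n))))

    below′ : Dom n (sw u i j) v
    below′ a b a≤n b≤n with i <? a ×-dec a ≤? j ×-dec u i <? b ×-dec b ≤? u j
    ... | no out = ≤-trans (dom a b a≤n b≤n) (≤-reflexive (sym (cnt-sw-outside u i<j ui<uj a b out)))
    ... | yes (i<a , a≤j , p , q) = s≤s⁻¹ (≤-trans (rect a b i<a a≤j p q)
      (≤-reflexive (sym (cnt-sw-inside u i<j a b i<a a≤j p q))))

-- Bruhat order on words

-- Extending by the identity embeds S_2m in S_2m+1, so that both parities of n share one encoding.
fun : ∀ {n} → Vec (Fin n) n → ℕ → ℕ
fun {n} u x with x <? n
... | yes x<n = toℕ (lookup u (fromℕ< x<n))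
... | no  _   = x

fun-< : ∀ {n} (u : Vec (Fin n) n) {x} (x<n : x < n) → fun u x ≡ toℕ (lookup u (fromℕ< x<n))
fun-< {n} u {x} x<n with x <? n
... | yes _  = refl
... | no x≮n = contradiction x<n x≮n

fun-≥ : ∀ {n} (u : Vec (Fin n) n) {x} → n ≤ x → fun u x ≡ x
fun-≥ {n} u {x} n≤x with x <? n
... | yes x<n = contradiction n≤x (<⇒≱ x<n)
... | no _    = refl

fun-toℕ : ∀ {n} (u : Vec (Fin n) n) i → fun u (toℕ i) ≡ toℕ (lookup u i)
fun-toℕ u i = trans (fun-< u (toℕ<n i)) (cong (toℕ ∘ lookup u) (fromℕ<-toℕ i (toℕ<n i)))

fun-perm : ∀ {n} {u : Vec (Fin n) n} → IsPerm u → Perm n (fun u)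
fun-perm {n} {u} π = record
  { bound = λ x x<n → subst (_< n) (sym (fun-< u x<n)) (toℕ<n _)
  ; inj   = λ x y x<n y<n e → begin
      x                  ≡⟨ sym (toℕ-fromℕ< x<n) ⟩
      toℕ (fromℕ< x<n)   ≡⟨ cong toℕ (π _ _ (toℕ-injective (trans (sym (fun-< u x<n)) (trans e (fun-< u y<n))))) ⟩
      toℕ (fromℕ< y<n)   ≡⟨ toℕ-fromℕ< y<n ⟩
      y                  ∎ }
  where open ≡-Reasoning

fun-isPerm : ∀ {n} {u : Vec (Fin n) n} → Perm n (fun u) → IsPerm u
fun-isPerm {n} {u} π i j e = toℕ-injective (inj π (toℕ i) (toℕ j) (toℕ<n i) (toℕ<n j)
  (trans (fun-toℕ u i) (trans (cong toℕ e) (sym (fun-toℕ u j)))))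

Perm-cong : ∀ {n u v} → (∀ x → x < n → u x ≡ v x) → Perm n u → Perm n v
Perm-cong {n} e π = record
  { bound = λ x x<n → subst (_< n) (e x x<n) (bound π x x<n)
  ; inj   = λ x y x<n y<n e′ → inj π x y x<n y<n (trans (e x x<n) (trans e′ (sym (e y y<n)))) }

fun-injective : ∀ {n} {u v : Vec (Fin n) n} → (∀ x → x < n → fun u x ≡ fun v x) → u ≡ v
fun-injective {u = u} {v} e = begin
  u                   ≡⟨ sym (tabulate∘lookup u) ⟩
  tabulate (lookup u) ≡⟨ tabulate-cong (λ i → toℕ-injective
                           (trans (sym (fun-toℕ u i)) (trans (e (toℕ i) (toℕ<n i)) (fun-toℕ v i)))) ⟩
  tabulate (lookup v) ≡⟨ tabulate∘lookup v ⟩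
  v                   ∎
  where open ≡-Reasoning

toVec : ∀ n (w : ℕ → ℕ) → (∀ x → x < n → w x < n) → Vec (Fin n) n
toVec n w bd = tabulate (λ i → fromℕ< (bd (toℕ i) (toℕ<n i)))

fun-toVec : ∀ n w bd x → x < n → fun (toVec n w bd) x ≡ w x
fun-toVec n w bd x x<n = begin
  fun (toVec n w bd) x                      ≡⟨ fun-< (toVec n w bd) x<n ⟩
  toℕ (lookup (toVec n w bd) (fromℕ< x<n))  ≡⟨ cong toℕ (lookup∘tabulate _ (fromℕ< x<n)) ⟩
  toℕ (fromℕ< (bd (toℕ k) (toℕ<n k)))       ≡⟨ toℕ-fromℕ< (bd (toℕ k) (toℕ<n k)) ⟩
  w (toℕ (fromℕ< x<n))                      ≡⟨ cong w (toℕ-fromℕ< x<n) ⟩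
  w x                                       ∎
  where
  open ≡-Reasoning
  k = fromℕ< x<n

toList-applyUpTo : ∀ {A : Set} {k} (g : A → ℕ) (f : ℕ → ℕ) (u : Vec A k) →
  (∀ i → g (lookup u i) ≡ f (toℕ i)) → toList (Vec.map g u) ≡ applyUpTo f k
toList-applyUpTo g f []      e = refl
toList-applyUpTo g f (x ∷ u) e =
  cong₂ _∷_ (e Fin.zero) (toList-applyUpTo g (f ∘ suc) u (e ∘ Fin.suc))

vals-fun : ∀ {n} (u : Vec (Fin n) n) → vals u ≡ applyUpTo (suc ∘ fun u) n
vals-fun u = toList-applyUpTo (suc ∘ toℕ) (suc ∘ fun u) u (λ i → cong suc (sym (fun-toℕ u i)))

cnt-head : ∀ w a b → cnt w (suc a) b ≡ ind (w 0) b + cnt (w ∘ suc) a b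
cnt-head w zero    b = sym (+-identityʳ _)
cnt-head w (suc a) b = trans (cong (_+ ind (w (suc a)) b) (cnt-head w a b)) (+-assoc (ind (w 0) b) _ _)

gt-head : ∀ w a b → gt w (suc a) b ≡ ind b (w 0) + gt (w ∘ suc) a b
gt-head w zero    b = sym (+-identityʳ _)
gt-head w (suc a) b = trans (cong (_+ ind b (w (suc a))) (gt-head w a b)) (+-assoc (ind b (w 0)) _ _)

-- `inv` groups inversions by their right end, which suits induction on prefixes, whereas `invs`
-- groups them by their left end. Splitting off the first letter mediates between the two.
inv-head : ∀ w a → inv w (suc a) ≡ cnt (w ∘ suc) a (w 0) + inv (w ∘ suc) a
inv-head w zero    = refl
inv-head w (suc a) = begin
  inv w (suc a) + gt w (suc a) z           ≡⟨ cong₂ _+_ (inv-head w a) (gt-head w a z) ⟩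
  (cnt w′ a (w 0) + inv w′ a) + (ind z (w 0) + gt w′ a z) ≡⟨ lem (cnt w′ a (w 0)) _ _ _ ⟩
  (cnt w′ a (w 0) + ind z (w 0)) + (inv w′ a + gt w′ a z) ∎
  where
  open ≡-Reasoning
  w′ = w ∘ suc
  z = w (suc a)
  lem : ∀ a b c d → (a + b) + (c + d) ≡ (a + c) + (b + d)
  lem = solve-∀

length-filter-< : ∀ w a b → length (filter (λ y → y <? b) (applyUpTo w a)) ≡ cnt w a b
length-filter-< w zero    b = refl
length-filter-< w (suc a) b with w 0 <? b
... | yes p = trans (cong length (filter-accept (λ y → y <? b) p))
  (sym (trans (cnt-head w a b) (cong₂ _+_ (ind-< p) (sym (length-filter-< (w ∘ suc) a b)))))
... | no ¬p = trans (cong length (filter-reject (λ y → y <? b) ¬p))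
  (sym (trans (cnt-head w a b) (cong₂ _+_ (ind-≥ (≮⇒≥ ¬p)) (sym (length-filter-< (w ∘ suc) a b)))))

invs-applyUpTo : ∀ w a → invs (applyUpTo w a) ≡ inv w a
invs-applyUpTo w zero    = refl
invs-applyUpTo w (suc a) = trans
  (cong₂ _+_ (length-filter-< (w ∘ suc) a (w 0)) (invs-applyUpTo (w ∘ suc) a))
  (sym (inv-head w a))

gt-suc : ∀ w a b → gt (suc ∘ w) a (suc b) ≡ gt w a b
gt-suc w zero    b = refl
gt-suc w (suc a) b = cong (_+ ind b (w a)) (gt-suc w a b)

inv-suc : ∀ w a → inv (suc ∘ w) a ≡ inv w a
inv-suc w zero    = refl
inv-suc w (suc a) = cong₂ _+_ (inv-suc w a) (gt-suc w a (w a))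

len-inv : ∀ {n} (u : Vec (Fin n) n) → len u ≡ inv (fun u) n
len-inv {n} u = trans (cong invs (vals-fun u)) (trans (invs-applyUpTo (suc ∘ fun u) n) (inv-suc (fun u) n))

fun-swap : ∀ {n} (u : Vec (Fin n) n) i j x → fun (swap u i j) x ≡ sw (fun u) (toℕ i) (toℕ j) x
fun-swap {n} u i j x with <-≤-connex x n
... | inj₂ n≤x = trans (fun-≥ (swap u i j) n≤x) (sym (trans
        (sw-other (fun u) (>⇒≢ (<-≤-trans (toℕ<n i) n≤x)) (>⇒≢ (<-≤-trans (toℕ<n j) n≤x)))
        (fun-≥ u n≤x)))
... | inj₁ x<n = trans (cong (fun (swap u i j)) (sym xk)) (trans (main k) (cong (sw (fun u) (toℕ i) (toℕ j)) xk))
  where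
  k = fromℕ< x<n
  xk : toℕ k ≡ x
  xk = toℕ-fromℕ< x<n
  main : ∀ k → fun (swap u i j) (toℕ k) ≡ sw (fun u) (toℕ i) (toℕ j) (toℕ k)
  main k with k Fin.≟ j
  ... | yes refl = begin
    fun (swap u i k) (toℕ k)             ≡⟨ fun-toℕ (swap u i k) k ⟩
    toℕ (lookup (swap u i k) k)          ≡⟨ cong toℕ (lookup∘update k (u [ i ]≔ lookup u k) (lookup u i)) ⟩
    toℕ (lookup u i)                     ≡⟨ sym (fun-toℕ u i) ⟩
    fun u (toℕ i)                        ≡⟨ sym (sw-j (fun u) (toℕ i) (toℕ k)) ⟩
    sw (fun u) (toℕ i) (toℕ k) (toℕ k)   ∎
    where open ≡-Reasoning
  ... | no k≢j with k Fin.≟ i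
  ...   | yes refl = begin
    fun (swap u k j) (toℕ k)             ≡⟨ fun-toℕ (swap u k j) k ⟩
    toℕ (lookup (swap u k j) k)          ≡⟨ cong toℕ (lookup∘update′ k≢j (u [ k ]≔ lookup u j) (lookup u k)) ⟩
    toℕ (lookup (u [ k ]≔ lookup u j) k) ≡⟨ cong toℕ (lookup∘update k u (lookup u j)) ⟩
    toℕ (lookup u j)                     ≡⟨ sym (fun-toℕ u j) ⟩
    fun u (toℕ j)                        ≡⟨ sym (sw-i (fun u) (toℕ k) (toℕ j)) ⟩
    sw (fun u) (toℕ k) (toℕ j) (toℕ k)   ∎
    where open ≡-Reasoning
  ...   | no k≢i = begin
    fun (swap u i j) (toℕ k)             ≡⟨ fun-toℕ (swap u i j) k ⟩
    toℕ (lookup (swap u i j) k)          ≡⟨ cong toℕ (lookup∘update′ k≢j (u [ i ]≔ lookup u j) (lookup u i)) ⟩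
    toℕ (lookup (u [ i ]≔ lookup u j) k) ≡⟨ cong toℕ (lookup∘update′ k≢i u (lookup u j)) ⟩
    toℕ (lookup u k)                     ≡⟨ sym (fun-toℕ u k) ⟩
    fun u (toℕ k)                        ≡⟨ sym (sw-other (fun u) (k≢i ∘ toℕ-injective) (k≢j ∘ toℕ-injective)) ⟩
    sw (fun u) (toℕ i) (toℕ j) (toℕ k)   ∎
    where open ≡-Reasoning

sw-sym : ∀ w i j x → sw w i j x ≡ sw w j i x
sw-sym w i j x = go (x ≟ i) (x ≟ j)
  where
  go : Dec (x ≡ i) → Dec (x ≡ j) → sw w i j x ≡ sw w j i x
  go (yes refl) _       = trans (sw-i w x j) (sym (sw-j w j x))
  go (no _) (yes refl)  = trans (sw-j w i x) (sym (sw-i w x i))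
  go (no p) (no q)      = trans (sw-other w p q) (sym (sw-other w q p))

sw-same : ∀ w i x → sw w i i x ≡ w x
sw-same w i x with x ≟ i
... | yes e = sym (cong w e)
... | no p with x ≟ i
...   | yes e = contradiction e p
...   | no _  = refl

sw-sw : ∀ w i j x → sw (sw w i j) i j x ≡ w x
sw-sw w i j x = go (x ≟ i) (x ≟ j)
  where
  go : Dec (x ≡ i) → Dec (x ≡ j) → sw (sw w i j) i j x ≡ w x
  go (yes refl) _        = trans (sw-i (sw w i j) i j) (sw-j w i j)
  go (no _)  (yes refl)  = trans (sw-j (sw w i j) i j) (sw-i w i j)
  go (no p)  (no q)      = trans (sw-other (sw w i j) p q) (sw-other w p q)

-- If w i > w j, the same swap applied to the swapped word is increasing, hence adds inversions; but
-- it leads back to w.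
inv-sw-increasing : ∀ {n w i j} → Perm n w → i < j → j < n → inv w n < inv (sw w i j) n → w i < w j
inv-sw-increasing {n} {w} {i} {j} π i<j j<n lt with <-cmp (w i) (w j)
... | tri< p _ _ = p
... | tri≈ _ e _ = contradiction (inj π i j (<-trans i<j j<n) j<n e) (<⇒≢ i<j)
... | tri> _ _ wj<wi = contradiction
  (<-trans lt (subst (inv w′ n <_) (inv-cong n (λ x _ → sw-sw w i j x))
    (inv-sw-< w′ (inj (sw-perm (<-trans i<j j<n) j<n π)) i<j j<n
      (subst₂ _<_ (sym (sw-i w i j)) (sym (sw-j w i j)) wj<wi))))
  (<-irrefl refl)
  where w′ = sw w i j

swap-isPerm : ∀ {n} (u : Vec (Fin n) n) i j → IsPerm u → IsPerm (swap u i j)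
swap-isPerm u i j π = fun-isPerm (Perm-cong (λ x _ → sym (fun-swap u i j x))
  (sw-perm (toℕ<n i) (toℕ<n j) (fun-perm π)))

step⇒Dom : ∀ {n} {u v : Vec (Fin n) n} → IsPerm u → BruhatStep u v →
  IsPerm v × ∀ N → Dom N (fun u) (fun v)
step⇒Dom {n} {u} π (i , j , refl , lt) = swap-isPerm u i j π , λ N →
  Dom-congʳ {u = w} (λ x _ → sym (fun-swap u i j x)) (dom N)
  where
  w = fun u
  i′ = toℕ i
  j′ = toℕ j
  lt′ : inv w n < inv (sw w i′ j′) n
  lt′ = subst₂ _<_ (len-inv u) (trans (len-inv (swap u i j)) (inv-cong n (λ x _ → fun-swap u i j x))) lt
  dom : ∀ N → Dom N w (sw w i′ j′)
  dom N with <-cmp i′ j′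
  ... | tri< i<j _ _ = sw-Dom w i<j (inv-sw-increasing (fun-perm π) i<j (toℕ<n j) lt′)
  ... | tri≈ _ e _ = contradiction
    (subst (inv w n <_) (inv-cong n (λ x _ → trans (cong (λ k → sw w i′ k x) (sym e)) (sw-same w i′ x))) lt′)
    (<-irrefl refl)
  ... | tri> _ _ j<i = Dom-congʳ {u = w} (λ x _ → sw-sym w j′ i′ x) (sw-Dom w j<i
    (inv-sw-increasing (fun-perm π) j<i (toℕ<n i) (subst (inv w n <_) (inv-cong n (λ x _ → sw-sym w i′ j′ x)) lt′)))

Bruhat⇒Dom : ∀ {n} {u v : Vec (Fin n) n} → IsPerm u → Bruhat≤ u v → ∀ N → Dom N (fun u) (fun v)
Bruhat⇒Dom {u = u} π done N = Dom-refl {u = fun u}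
Bruhat⇒Dom {u = u} {v} π (s ◅ ss) N with step⇒Dom π s
... | π′ , d = Dom-trans {u = fun u} {w = fun v} (d N) (Bruhat⇒Dom π′ ss N)

-- `coverSwap` is iterated until it reports equality. Each swap adds exactly one inversion and there
-- are never more than n · n, which provides the fuel.
Dom⇒Bruhat : ∀ {n} {u v : Vec (Fin n) n} → IsPerm u → IsPerm v → Dom n (fun u) (fun v) → Bruhat≤ u v
Dom⇒Bruhat {n} {u} {v} πu πv = go (n * n) u πu (m≤n+m (n * n) (inv (fun u) n))
  where
  go : ∀ fuel u → IsPerm u → n * n ≤ inv (fun u) n + fuel → Dom n (fun u) (fun v) → Bruhat≤ u v
  go fuel u πu le dom with coverSwap (fun-perm πu) (fun-perm πv) dom
  ... | inj₁ e = subst (Bruhat≤ u) (fun-injective e) done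
  ... | inj₂ record { i = i ; j = j ; i<j = i<j ; j<n = j<n ; ui<uj = ui<uj ; empty = em ; below = below } = next fuel le
    where
    i<n : i < n
    i<n = <-trans i<j j<n
    i′ = fromℕ< i<n
    j′ = fromℕ< j<n
    u′ = swap u i′ j′
    u′≡ : ∀ x → sw (fun u) i j x ≡ fun u′ x
    u′≡ x = trans (cong₂ (λ k l → sw (fun u) k l x) (sym (toℕ-fromℕ< i<n)) (sym (toℕ-fromℕ< j<n)))
                  (sym (fun-swap u i′ j′ x))
    lt : inv (fun u′) n ≡ suc (inv (fun u) n)
    lt = trans (inv-cong n (λ x _ → sym (u′≡ x))) (inv-sw-cover (fun u) (inj (fun-perm πu)) i<j j<n ui<uj em)
    next : ∀ fuel → n * n ≤ inv (fun u) n + fuel → Bruhat≤ u v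
    -- Without fuel the word already has n · n inversions, so one more swap would exceed the bound
    -- `inv≤`.
    next zero le = contradiction (inv≤ (fun u′) n n ≤-refl)
      (<⇒≱ (subst (n * n <_) (sym lt) (s≤s (subst (n * n ≤_) (+-identityʳ _) le))))
    next (suc fuel) le =
      (i′ , j′ , refl , subst₂ _<_ (sym (len-inv u)) (sym (trans (len-inv u′) lt)) ≤-refl) ◅
      go fuel u′ (swap-isPerm u i′ j′ πu)
        (subst (n * n ≤_) (trans (+-suc _ fuel) (cong (_+ fuel) (sym lt))) le)
        (Dom-congˡ {v = fun v} (λ x _ → u′≡ x) below)

-- Blocks

dbl : ℕ → ℕ
dbl zero    = 0
dbl (suc a) = suc (suc (dbl a))

dbl-mono : ∀ {a b} → a ≤ b → dbl a ≤ dbl b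
dbl-mono z≤n     = z≤n
dbl-mono (s≤s p) = s≤s (s≤s (dbl-mono p))

dbl-cancel-< : ∀ {a b} → dbl a < dbl b → a < b
dbl-cancel-< {a} {b} p with <-≤-connex a b
... | inj₁ q = q
... | inj₂ q = contradiction (dbl-mono q) (<⇒≱ p)

dbl-cancel-≤ : ∀ {a b} → dbl a ≤ dbl b → a ≤ b
dbl-cancel-≤ {a} {b} p with <-≤-connex b a
... | inj₁ q = contradiction p (<⇒≱ (≤-trans (n≤1+n _) (dbl-mono q)))
... | inj₂ q = q

dbl-+ : ∀ a → dbl a ≡ a + a
dbl-+ zero    = refl
dbl-+ (suc a) = cong suc (trans (cong suc (dbl-+ a)) (sym (+-suc a a)))

evenOrOdd : ∀ x → (∃ λ a → x ≡ dbl a) ⊎ (∃ λ a → x ≡ suc (dbl a))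
evenOrOdd zero = inj₁ (0 , refl)
evenOrOdd (suc x) with evenOrOdd x
... | inj₁ (a , e) = inj₂ (a , cong suc e)
... | inj₂ (a , e) = inj₁ (suc a , cong suc e)

χ : Bool → ℕ
χ false = 0
χ true  = 1

χ≤1 : ∀ e → χ e ≤ 1
χ≤1 false = z≤n
χ≤1 true  = ≤-refl

b≢not-b : ∀ c → c ≢ not c
b≢not-b false ()
b≢not-b true ()

dig : ℕ → Bool → ℕ
dig t false = dbl t
dig t true  = suc (dbl t)

dig-< : ∀ {t m} e → t < m → dig t e < dbl m
dig-< false p = ≤-trans (n≤1+n _) (dbl-mono p)
dig-< true  p = dbl-mono p

dig-view : ∀ x → ∃ λ t → ∃ λ e → x ≡ dig t e
dig-view x with evenOrOdd x
... | inj₁ (t , p) = t , false , p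
... | inj₂ (t , p) = t , true , p

dig-injective : ∀ t s d e → dig t d ≡ dig s e → t ≡ s × d ≡ e
dig-injective zero    zero    false false _ = refl , refl
dig-injective zero    zero    true  true  _ = refl , refl
dig-injective (suc t) (suc s) d e p with dig-injective t s d e (pred² t s d e p)
  where
  pred² : ∀ t s d e → dig (suc t) d ≡ dig (suc s) e → dig t d ≡ dig s e
  pred² t s false false p = cong (pred ∘ pred) p
  pred² t s false true  p = cong (pred ∘ pred) p
  pred² t s true  false p = cong (pred ∘ pred) p
  pred² t s true  true  p = cong (pred ∘ pred) p
... | refl , refl = refl , refl
dig-injective zero (suc s) false false ()
dig-injective zero (suc s) false true ()
dig-injective zero (suc s) true false ()
dig-injective zero (suc s) true true ()
dig-injective (suc t) zero false false ()
dig-injective (suc t) zero false true ()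
dig-injective (suc t) zero true false ()
dig-injective (suc t) zero true true ()

ind-dig-even : ∀ t e b → ind (dig t e) (dbl b) ≡ ind t b
ind-dig-even t       e     zero    = refl
ind-dig-even zero    false (suc b) = refl
ind-dig-even zero    true  (suc b) = refl
ind-dig-even (suc t) false (suc b) = ind-dig-even t false b
ind-dig-even (suc t) true  (suc b) = ind-dig-even t true b

ind-dbl-odd : ∀ t b → ind (dbl t) (suc (dbl b)) ≡ ind t (suc b)
ind-dbl-odd zero    b       = refl
ind-dbl-odd (suc t) zero    = refl
ind-dbl-odd (suc t) (suc b) = ind-dbl-odd t b

-- The two letters of a block are counted together, so their order e drops out; this is why even
-- rows do not see ε.
ind-dig-pair : ∀ t e b → ind (dig t e) (suc (dbl b)) + ind (dig t (not e)) (suc (dbl b)) ≡ ind t b + ind t (suc b)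
ind-dig-pair t false b = trans (cong₂ _+_ (ind-dbl-odd t b) (ind-dig-even t false b)) (+-comm (ind t (suc b)) _)
ind-dig-pair t true  b = cong₂ _+_ (ind-dig-even t false b) (ind-dbl-odd t b)

ind-dig-dot : ∀ t e → ind (dig t e) (suc (dbl t)) ≡ χ (not e)
ind-dig-dot t false = ind-< {dbl t} ≤-refl
ind-dig-dot t true  = ind-≥ {suc (dbl t)} ≤-refl

ind-dig-off : ∀ t e b → t ≢ b → ind (dig t e) (suc (dbl b)) ≡ ind t b
ind-dig-off t false b t≢b = trans (ind-dbl-odd t b) (ind-suc-≢ t≢b)
ind-dig-off t true  b t≢b = ind-dig-even t false b

ind-dig-≢ : ∀ {t s} d e → t ≢ s → ind (dig t d) (dig s e) ≡ ind t s
ind-dig-≢ {t} {s} d false t≢s = ind-dig-even t d s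
ind-dig-≢ {t} {s} d true  t≢s = ind-dig-off t d s t≢s

ind-dig-not : ∀ t e → ind (dig t (not e)) (dig t e) ≡ χ e
ind-dig-not t false = ind-≥ (n≤1+n (dbl t))
ind-dig-not t true  = ind-< {dbl t} ≤-refl

-- Block a occupies the positions 2a, 2a+1 and holds the letters 2τ(a), 2τ(a)+1.
blow : (ℕ → ℕ) → (ℕ → Bool) → ℕ → ℕ
blow τ ε zero          = dig (τ 0) (ε 0)
blow τ ε (suc zero)    = dig (τ 0) (not (ε 0))
blow τ ε (suc (suc x)) = blow (τ ∘ suc) (ε ∘ suc) x

blow-even : ∀ τ ε a → blow τ ε (dbl a) ≡ dig (τ a) (ε a)
blow-even τ ε zero    = refl
blow-even τ ε (suc a) = blow-even (τ ∘ suc) (ε ∘ suc) a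

blow-odd : ∀ τ ε a → blow τ ε (suc (dbl a)) ≡ dig (τ a) (not (ε a))
blow-odd τ ε zero    = refl
blow-odd τ ε (suc a) = blow-odd (τ ∘ suc) (ε ∘ suc) a

blow-< : ∀ {m τ} ε → (∀ x → x < m → τ x < m) → ∀ x → x < dbl m → blow τ ε x < dbl m
blow-< {m} {τ} ε bd x p with evenOrOdd x
... | inj₁ (a , refl) = subst (_< dbl m) (sym (blow-even τ ε a)) (dig-< (ε a) (bd a (dbl-cancel-< p)))
... | inj₂ (a , refl) = subst (_< dbl m) (sym (blow-odd τ ε a)) (dig-< (not (ε a)) (bd a (dbl-cancel-< (<⇒≤ p))))

blow-inj : ∀ {m τ} ε → Inj< m τ → Inj< (dbl m) (blow τ ε)
blow-inj {m} {τ} ε inj-τ x y p q e with evenOrOdd x | evenOrOdd y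
... | inj₁ (a , refl) | inj₁ (b , refl) =
  cong dbl (inj-τ a b (dbl-cancel-< p) (dbl-cancel-< q)
    (proj₁ (dig-injective _ _ (ε a) (ε b) (trans (sym (blow-even τ ε a)) (trans e (blow-even τ ε b))))))
... | inj₂ (a , refl) | inj₂ (b , refl) =
  cong (suc ∘ dbl) (inj-τ a b (dbl-cancel-< (<⇒≤ p)) (dbl-cancel-< (<⇒≤ q))
    (proj₁ (dig-injective _ _ (not (ε a)) (not (ε b)) (trans (sym (blow-odd τ ε a)) (trans e (blow-odd τ ε b))))))
... | inj₁ (a , refl) | inj₂ (b , refl)
  with dig-injective _ _ (ε a) (not (ε b)) (trans (sym (blow-even τ ε a)) (trans e (blow-odd τ ε b)))
...   | e₁ , e₂ with inj-τ a b (dbl-cancel-< p) (dbl-cancel-< (<⇒≤ q)) e₁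
...     | refl = contradiction e₂ (b≢not-b (ε a))
blow-inj {m} {τ} ε inj-τ x y p q e | inj₂ (a , refl) | inj₁ (b , refl)
  with dig-injective _ _ (not (ε a)) (ε b) (trans (sym (blow-odd τ ε a)) (trans e (blow-even τ ε b)))
...   | e₁ , e₂ with inj-τ a b (dbl-cancel-< (<⇒≤ p)) (dbl-cancel-< q) e₁
...     | refl = contradiction (sym e₂) (b≢not-b (ε a))

-- The part of the count at the centre (2a + 1, 2b + 1) of the cell (a, b) that τ forces. It is the
-- whole count if τ has no dot in the cell; at a dot an unreversed block adds one to it.
base : (ℕ → ℕ) → ℕ → ℕ → ℕ
base τ a b = cnt τ (suc a) b + cnt τ a (suc b)

center : (ℕ → ℕ) → (ℕ → Bool) → ℕ → ℕ → ℕ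
center τ ε a b = cnt (blow τ ε) (suc (dbl a)) (suc (dbl b))

module _ (τ : ℕ → ℕ) (ε : ℕ → Bool) where

  cnt-blow-00 : ∀ a b → cnt (blow τ ε) (dbl a) (dbl b) ≡ cnt τ a b + cnt τ a b
  cnt-blow-00 zero    b = refl
  cnt-blow-00 (suc a) b = trans
    (cong₂ _+_ (cong₂ _+_ (cnt-blow-00 a b)
      (trans (cong (λ z → ind z (dbl b)) (blow-even τ ε a)) (ind-dig-even (τ a) (ε a) b)))
      (trans (cong (λ z → ind z (dbl b)) (blow-odd τ ε a)) (ind-dig-even (τ a) (not (ε a)) b)))
    (lem (cnt τ a b) (ind (τ a) b))
    where
    lem : ∀ a b → a + a + b + b ≡ (a + b) + (a + b)
    lem = solve-∀

  cnt-blow-01 : ∀ a b → cnt (blow τ ε) (dbl a) (suc (dbl b)) ≡ cnt τ a b + cnt τ a (suc b)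
  cnt-blow-01 zero    b = refl
  cnt-blow-01 (suc a) b = begin
    c + ind (blow τ ε (dbl a)) B + ind (blow τ ε (suc (dbl a))) B ≡⟨ +-assoc c _ _ ⟩
    c + (ind (blow τ ε (dbl a)) B + ind (blow τ ε (suc (dbl a))) B) ≡⟨ cong₂ _+_ (cnt-blow-01 a b)
      (trans (cong₂ (λ y z → ind y B + ind z B) (blow-even τ ε a) (blow-odd τ ε a)) (ind-dig-pair (τ a) (ε a) b)) ⟩
    (cnt τ a b + cnt τ a (suc b)) + (ind (τ a) b + ind (τ a) (suc b)) ≡⟨ lem (cnt τ a b) _ _ _ ⟩
    (cnt τ a b + ind (τ a) b) + (cnt τ a (suc b) + ind (τ a) (suc b)) ∎
    where
    open ≡-Reasoning
    B = suc (dbl b)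
    c = cnt (blow τ ε) (dbl a) B
    lem : ∀ a b c d → (a + b) + (c + d) ≡ (a + c) + (b + d)
    lem = solve-∀

  cnt-blow-10 : ∀ a b → cnt (blow τ ε) (suc (dbl a)) (dbl b) ≡ cnt τ a b + cnt τ (suc a) b
  cnt-blow-10 a b = trans
    (cong₂ _+_ (cnt-blow-00 a b) (trans (cong (λ z → ind z (dbl b)) (blow-even τ ε a)) (ind-dig-even (τ a) (ε a) b)))
    (+-assoc (cnt τ a b) _ _)

  private
    rot : ∀ a b c → a + b + c ≡ (a + c) + b
    rot = solve-∀

  center-off : ∀ a b → τ a ≢ b → center τ ε a b ≡ base τ a b
  center-off a b ne = trans
    (cong₂ _+_ (cnt-blow-01 a b) (trans (cong (λ z → ind z (suc (dbl b))) (blow-even τ ε a)) (ind-dig-off (τ a) (ε a) b ne)))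
    (rot (cnt τ a b) _ _)

  center-dot : ∀ a → center τ ε a (τ a) ≡ base τ a (τ a) + χ (not (ε a))
  center-dot a = begin
    cnt (blow τ ε) (dbl a) (suc (dbl (τ a))) + ind (blow τ ε (dbl a)) (suc (dbl (τ a)))
      ≡⟨ cong₂ _+_ (cnt-blow-01 a (τ a)) (trans (cong (λ z → ind z (suc (dbl (τ a)))) (blow-even τ ε a)) (ind-dig-dot (τ a) (ε a))) ⟩
    cnt τ a (τ a) + cnt τ a (suc (τ a)) + χ (not (ε a))
      ≡⟨ cong (λ c → c + cnt τ a (suc (τ a)) + χ (not (ε a))) (sym (trans (cong (cnt τ a (τ a) +_) (ind-≥ {τ a} ≤-refl)) (+-identityʳ _))) ⟩
    base τ a (τ a) + χ (not (ε a)) ∎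
    where open ≡-Reasoning

  center≥base : ∀ a b → base τ a b ≤ center τ ε a b
  center≥base a b with τ a ≟ b
  ... | yes refl = ≤-trans (m≤m+n _ _) (≤-reflexive (sym (center-dot a)))
  ... | no ne    = ≤-reflexive (sym (center-off a b ne))

cnt-mono : ∀ w {a a′} b → a ≤ a′ → cnt w a b ≤ cnt w a′ b
cnt-mono w {a} {zero}   b z≤n = z≤n
cnt-mono w {a} {suc a′} b p with m≤n⇒m<n∨m≡n p
... | inj₁ q    = ≤-trans (cnt-mono w b (s≤s⁻¹ q)) (m≤m+n _ _)
... | inj₂ refl = ≤-refl

base-mono : ∀ {m τ τ′} → Dom m τ τ′ → ∀ a b → a < m → b < m → base τ′ a b ≤ base τ a b
base-mono dom a b a<m b<m = +-mono-≤ (dom (suc a) b a<m (<⇒≤ b<m)) (dom a (suc b) (<⇒≤ a<m) b<m)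

-- A dot of τ′ that τ lacks forces a gap in its cell. If τ has its dot of row a further left, row a
-- already contributes to column b in τ but not in τ′. If further right, the comparison at (a + 1, b
-- + 1) gives τ′ one letter in row a and τ none, so τ must have been ahead in row a. The gap pays
-- for the unit that an unreversed block of τ′ adds.
base-strict : ∀ {m τ τ′} → Dom m τ τ′ → ∀ a → a < m → τ′ a < m → τ a ≢ τ′ a → base τ′ a (τ′ a) < base τ a (τ′ a)
base-strict {m} {τ} {τ′} dom a a<m b<m ne with <-≤-connex (τ a) (τ′ a)
... | inj₁ τa<b = begin
  suc (cnt τ′ a b + ind b b + cnt τ′ a (suc b)) ≡⟨ cong (λ z → suc (cnt τ′ a b + z + cnt τ′ a (suc b))) (ind-≥ {b} ≤-refl) ⟩
  suc (cnt τ′ a b + 0 + cnt τ′ a (suc b))       ≡⟨ lem (cnt τ′ a b) _ ⟩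
  cnt τ′ a b + 1 + cnt τ′ a (suc b)             ≤⟨ +-mono-≤ (+-monoˡ-≤ 1 (dom a b (<⇒≤ a<m) (<⇒≤ b<m))) (dom a (suc b) (<⇒≤ a<m) b<m) ⟩
  cnt τ a b + 1 + cnt τ a (suc b)               ≡⟨ cong (λ z → cnt τ a b + z + cnt τ a (suc b)) (sym (ind-< τa<b)) ⟩
  base τ a b                                    ∎
  where
  open ≤-Reasoning
  b = τ′ a
  lem : ∀ a b → suc (a + 0 + b) ≡ a + 1 + b
  lem = solve-∀
... | inj₂ b≤τa = +-mono-≤-< (dom (suc a) b a<m (<⇒≤ b<m)) (begin
  suc (cnt τ′ a (suc b))               ≡⟨ +-comm 1 _ ⟩
  cnt τ′ a (suc b) + 1                 ≡⟨ cong (cnt τ′ a (suc b) +_) (sym (ind-< {b} ≤-refl)) ⟩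
  cnt τ′ (suc a) (suc b)               ≤⟨ dom (suc a) (suc b) a<m b<m ⟩
  cnt τ a (suc b) + ind (τ a) (suc b)  ≡⟨ cong (cnt τ a (suc b) +_) (ind-≥ (≤∧≢⇒< b≤τa (ne ∘ sym))) ⟩
  cnt τ a (suc b) + 0                  ≡⟨ +-identityʳ _ ⟩
  cnt τ a (suc b)                      ∎)
  where
  open ≤-Reasoning
  b = τ′ a

-- What the middle of the 2×2 cell of a common dot of τ and τ′ contributes to the comparison.
Stuck≤ : (τ τ′ : ℕ → ℕ) (ε ε′ : ℕ → Bool) → ℕ → Set
Stuck≤ τ τ′ ε ε′ a = τ a ≡ τ′ a → χ (ε a) ≤ χ (ε′ a) ⊎ base τ′ a (τ a) < base τ a (τ a)

χ-not-anti : ∀ d e → χ d ≤ χ e → χ (not e) ≤ χ (not d)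
χ-not-anti false e     p = χ≤1 (not e)
χ-not-anti true  true  p = z≤n

center-mono : ∀ {m τ τ′ ε ε′} → Dom m τ τ′ → ∀ a b → a < m → b < m → Stuck≤ τ τ′ ε ε′ a →
  center τ′ ε′ a b ≤ center τ ε a b
center-mono {m} {τ} {τ′} {ε} {ε′} dom a b a<m b<m st with τ′ a ≟ b
... | no ne′ = ≤-trans (≤-reflexive (center-off τ′ ε′ a b ne′))
                 (≤-trans (base-mono dom a b a<m b<m) (center≥base τ ε a b))
... | yes refl with τ a ≟ b
...   | no ne = begin
  center τ′ ε′ a b             ≡⟨ center-dot τ′ ε′ a ⟩
  base τ′ a b + χ (not (ε′ a)) ≤⟨ +-monoʳ-≤ (base τ′ a b) (χ≤1 (not (ε′ a))) ⟩
  base τ′ a b + 1              ≡⟨ +-comm _ 1 ⟩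
  suc (base τ′ a b)            ≤⟨ base-strict dom a a<m b<m ne ⟩
  base τ a b                   ≡⟨ sym (center-off τ ε a b ne) ⟩
  center τ ε a b               ∎
  where open ≤-Reasoning
...   | yes e = begin
  center τ′ ε′ a b             ≡⟨ center-dot τ′ ε′ a ⟩
  base τ′ a b + χ (not (ε′ a)) ≤⟨ main (st e) ⟩
  base τ a b + χ (not (ε a))   ≡⟨ sym (subst (λ c → center τ ε a c ≡ base τ a c + χ (not (ε a))) e (center-dot τ ε a)) ⟩
  center τ ε a b               ∎
  where
  open ≤-Reasoning
  main : χ (ε a) ≤ χ (ε′ a) ⊎ base τ′ a (τ a) < base τ a (τ a) →
         base τ′ a b + χ (not (ε′ a)) ≤ base τ a b + χ (not (ε a))
  main (inj₁ p) = +-mono-≤ (base-mono dom a b a<m b<m) (χ-not-anti (ε a) (ε′ a) p)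
  main (inj₂ p) = begin
    base τ′ a b + χ (not (ε′ a)) ≤⟨ +-monoʳ-≤ (base τ′ a b) (χ≤1 (not (ε′ a))) ⟩
    base τ′ a b + 1              ≡⟨ +-comm _ 1 ⟩
    suc (base τ′ a b)            ≤⟨ subst (λ c → base τ′ a c < base τ a c) e p ⟩
    base τ a b                   ≤⟨ m≤m+n _ _ ⟩
    base τ a b + χ (not (ε a))   ∎

-- Only a reversed block against an unreversed one needs an argument: then the right side of the
-- hypothesis is `base` alone and the left side is `base` plus one, which is the gap.
center⇒Stuck≤ : ∀ {τ τ′ ε ε′} a → center τ′ ε′ a (τ a) ≤ center τ ε a (τ a) → Stuck≤ τ τ′ ε ε′ a
center⇒Stuck≤ {τ} {τ′} {ε} {ε′} a le e with ε a in p | ε′ a in q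
... | false | _    = inj₁ z≤n
... | true  | true = inj₁ ≤-refl
... | true  | false = inj₂ (begin
  suc (base τ′ a b)            ≡⟨ +-comm 1 _ ⟩
  base τ′ a b + χ (not false)  ≡⟨ cong (λ c → base τ′ a b + χ (not c)) (sym q) ⟩
  base τ′ a b + χ (not (ε′ a)) ≡⟨ sym (subst (λ c → center τ′ ε′ a c ≡ base τ′ a c + χ (not (ε′ a))) (sym e) (center-dot τ′ ε′ a)) ⟩
  center τ′ ε′ a b             ≤⟨ le ⟩
  center τ ε a b               ≡⟨ center-dot τ ε a ⟩
  base τ a b + χ (not (ε a))   ≡⟨ cong (λ c → base τ a b + χ (not c)) p ⟩
  base τ a b + 0               ≡⟨ +-identityʳ _ ⟩
  base τ a b                   ∎)
  where
  open ≤-Reasoning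
  b = τ a

blow-Dom-even : ∀ {m τ τ′} ε ε′ → Dom m τ τ′ → ∀ a B → a ≤ m → B ≤ dbl m →
  cnt (blow τ′ ε′) (dbl a) B ≤ cnt (blow τ ε) (dbl a) B
blow-Dom-even {m} {τ} {τ′} ε ε′ dom a B a≤m B≤ with evenOrOdd B
... | inj₁ (b , refl) = subst₂ _≤_ (sym (cnt-blow-00 τ′ ε′ a b)) (sym (cnt-blow-00 τ ε a b)) (+-mono-≤ le le)
  where
  le : cnt τ′ a b ≤ cnt τ a b
  le = dom a b a≤m (dbl-cancel-≤ B≤)
... | inj₂ (b , refl) = subst₂ _≤_ (sym (cnt-blow-01 τ′ ε′ a b)) (sym (cnt-blow-01 τ ε a b))
  (+-mono-≤ (dom a b a≤m (<⇒≤ b<m)) (dom a (suc b) a≤m b<m))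
  where
  b<m : b < m
  b<m = dbl-cancel-< B≤

blow-Dom-odd : ∀ {m τ τ′ ε ε′} → Dom m τ τ′ → ∀ a B → a < m → B ≤ dbl m → Stuck≤ τ τ′ ε ε′ a →
  cnt (blow τ′ ε′) (suc (dbl a)) B ≤ cnt (blow τ ε) (suc (dbl a)) B
blow-Dom-odd {m} {τ} {τ′} {ε} {ε′} dom a B a<m B≤ st with evenOrOdd B
... | inj₁ (b , refl) = subst₂ _≤_ (sym (cnt-blow-10 τ′ ε′ a b)) (sym (cnt-blow-10 τ ε a b))
  (+-mono-≤ (dom a b (<⇒≤ a<m) b≤m) (dom (suc a) b a<m b≤m))
  where
  b≤m : b ≤ m
  b≤m = dbl-cancel-≤ B≤
... | inj₂ (b , refl) = center-mono {ε = ε} {ε′} dom a b a<m (dbl-cancel-< B≤) st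

-- Deleting the position of the largest letter

skip : ℕ → ℕ → ℕ
skip zero    x       = suc x
skip (suc q) zero    = 0
skip (suc q) (suc x) = suc (skip q x)

skip-< : ∀ {q x} → x < q → skip q x ≡ x
skip-< {suc q} {zero}  _       = refl
skip-< {suc q} {suc x} (s≤s p) = cong suc (skip-< p)

skip-≥ : ∀ {q x} → q ≤ x → skip q x ≡ suc x
skip-≥ {zero}          _       = refl
skip-≥ {suc q} {suc x} (s≤s p) = cong suc (skip-≥ p)

skip-≢ : ∀ q x → skip q x ≢ q
skip-≢ (suc q) (suc x) e = skip-≢ q x (suc-injective e)

skip-injective : ∀ q x y → skip q x ≡ skip q y → x ≡ y
skip-injective zero    x       y       e = suc-injective e
skip-injective (suc q) zero    zero    e = refl
skip-injective (suc q) (suc x) (suc y) e = cong suc (skip-injective q x y (suc-injective e))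

unskip : ∀ q k → k ≡ q ⊎ ∃ λ x → k ≡ skip q x
unskip zero    zero    = inj₁ refl
unskip zero    (suc k) = inj₂ (k , refl)
unskip (suc q) zero    = inj₂ (0 , refl)
unskip (suc q) (suc k) with unskip q k
... | inj₁ e       = inj₁ (cong suc e)
... | inj₂ (x , e) = inj₂ (suc x , cong suc e)

skip-<⁻ : ∀ {q N} x → q ≤ N → skip q x < suc N → x < N
skip-<⁻ {q} {N} x q≤N p with <-≤-connex x q
... | inj₁ x<q = <-≤-trans x<q q≤N
... | inj₂ q≤x = s≤s⁻¹ (subst (_< suc N) (skip-≥ q≤x) p)

skip-≤ : ∀ q x → skip q x ≤ suc x
skip-≤ q x with <-≤-connex x q
... | inj₁ x<q = ≤-trans (≤-reflexive (skip-< x<q)) (n≤1+n x)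
... | inj₂ q≤x = ≤-reflexive (skip-≥ q≤x)

cnt-skip-≤ : ∀ w q a b → a ≤ q → cnt w a b ≡ cnt (w ∘ skip q) a b
cnt-skip-≤ w q a b a≤q = cnt-cong a b (λ x x<a → cong w (sym (skip-< (<-≤-trans x<a a≤q))))

cnt-skip-> : ∀ w q a b → q ≤ a → cnt w (suc a) b ≡ cnt (w ∘ skip q) a b + ind (w q) b
cnt-skip-> w q a b q≤a with m≤n⇒m<n∨m≡n q≤a
... | inj₂ refl = cong (_+ ind (w q) b) (cnt-skip-≤ w q a b ≤-refl)
cnt-skip-> w q (suc a) b q≤a | inj₁ q<a = begin
  cnt w (suc a) b + ind (w (suc a)) b                             ≡⟨ cong₂ (λ c k → c + ind (w k) b) (cnt-skip-> w q a b (s≤s⁻¹ q<a)) (sym (skip-≥ (s≤s⁻¹ q<a))) ⟩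
  cnt (w ∘ skip q) a b + ind (w q) b + ind (w (skip q a)) b       ≡⟨ lem (cnt (w ∘ skip q) a b) _ _ ⟩
  cnt (w ∘ skip q) a b + ind (w (skip q a)) b + ind (w q) b       ∎
  where
  open ≡-Reasoning
  lem : ∀ a b c → a + b + c ≡ a + c + b
  lem = solve-∀

gt-skip-≤ : ∀ w q a b → a ≤ q → gt w a b ≡ gt (w ∘ skip q) a b
gt-skip-≤ w q a b a≤q = gt-cong a b (λ x x<a → cong w (sym (skip-< (<-≤-trans x<a a≤q))))

gt-skip-> : ∀ w q a b → q ≤ a → gt w (suc a) b ≡ gt (w ∘ skip q) a b + ind b (w q)
gt-skip-> w q a b q≤a with m≤n⇒m<n∨m≡n q≤a
... | inj₂ refl = cong (_+ ind b (w q)) (gt-skip-≤ w q a b ≤-refl)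
gt-skip-> w q (suc a) b q≤a | inj₁ q<a = begin
  gt w (suc a) b + ind b (w (suc a))                             ≡⟨ cong₂ (λ c k → c + ind b (w k)) (gt-skip-> w q a b (s≤s⁻¹ q<a)) (sym (skip-≥ (s≤s⁻¹ q<a))) ⟩
  gt (w ∘ skip q) a b + ind b (w q) + ind b (w (skip q a))       ≡⟨ lem (gt (w ∘ skip q) a b) _ _ ⟩
  gt (w ∘ skip q) a b + ind b (w (skip q a)) + ind b (w q)       ∎
  where
  open ≡-Reasoning
  lem : ∀ a b c → a + b + c ≡ a + c + b
  lem = solve-∀

gt-≡0 : ∀ w a b → (∀ x → x < a → w x ≤ b) → gt w a b ≡ 0
gt-≡0 w zero    b h = refl
gt-≡0 w (suc a) b h = cong₂ _+_ (gt-≡0 w a b (λ x p → h x (m<n⇒m<1+n p))) (ind-≥ (h a ≤-refl))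

-- The letter at q exceeds all others, so it is inverted exactly with the a - q letters behind it.
inv-skip : ∀ w q a → q ≤ a → (∀ x → x < a → w (skip q x) < w q) →
  inv w (suc a) ≡ inv (w ∘ skip q) a + (a ∸ q)
inv-skip w q a q≤a top with m≤n⇒m<n∨m≡n q≤a
... | inj₂ refl = cong₂ _+_ (inv-cong a (λ x x<a → cong w (sym (skip-< x<a))))
  (trans (trans (gt-skip-≤ w q a (w a) ≤-refl) (gt-≡0 (w ∘ skip q) a (w q) (λ x p → <⇒≤ (top x p))))
         (sym (n∸n≡0 a)))
inv-skip w q (suc a) q≤a top | inj₁ q<a = begin
  inv w (suc a) + gt w (suc a) (w (suc a))
    ≡⟨ cong₂ _+_ (inv-skip w q a (s≤s⁻¹ q<a) (λ x p → top x (m<n⇒m<1+n p)))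
                 (trans (cong (λ k → gt w (suc a) (w k)) (sym (skip-≥ (s≤s⁻¹ q<a)))) (gt-skip-> w q a (h a) (s≤s⁻¹ q<a))) ⟩
  (inv h a + (a ∸ q)) + (gt h a (h a) + ind (h a) (w q)) ≡⟨ cong (λ c → (inv h a + (a ∸ q)) + (gt h a (h a) + c)) (ind-< (top a ≤-refl)) ⟩
  (inv h a + (a ∸ q)) + (gt h a (h a) + 1)               ≡⟨ lem (inv h a) _ _ ⟩
  (inv h a + gt h a (h a)) + suc (a ∸ q)                 ≡⟨ cong ((inv h a + gt h a (h a)) +_) (sym (+-∸-assoc 1 (s≤s⁻¹ q<a))) ⟩
  (inv h a + gt h a (h a)) + (suc a ∸ q)                 ∎
  where
  open ≡-Reasoning
  h = w ∘ skip q
  lem : ∀ a b c → (a + b) + (c + 1) ≡ (a + c) + suc b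
  lem = solve-∀

-- Inversions of block words

tot : (ℕ → Bool) → ℕ → ℕ
tot ε zero    = 0
tot ε (suc a) = tot ε a + χ (ε a)

gt-blow : ∀ τ ε a t e → (∀ x → x < a → t ≢ τ x) →
  gt (blow τ ε) (dbl a) (dig t e) ≡ gt τ a t + gt τ a t
gt-blow τ ε zero    t e ne = refl
gt-blow τ ε (suc a) t e ne = trans
  (cong₂ _+_ (cong₂ _+_ (gt-blow τ ε a t e (λ x p → ne x (m<n⇒m<1+n p)))
    (trans (cong (ind (dig t e)) (blow-even τ ε a)) (ind-dig-≢ e (ε a) (ne a ≤-refl))))
    (trans (cong (ind (dig t e)) (blow-odd τ ε a)) (ind-dig-≢ e (not (ε a)) (ne a ≤-refl))))
  (lem (gt τ a t) (ind t (τ a)))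
  where
  lem : ∀ a b → a + a + b + b ≡ (a + b) + (a + b)
  lem = solve-∀

-- Two inverted blocks contribute all four pairs of letters across them, and a reversed block
-- contributes one pair inside.
inv-blow : ∀ {m} τ ε a → a ≤ m → Inj< m τ → inv (blow τ ε) (dbl a) ≡ 4 * inv τ a + tot ε a
inv-blow τ ε zero    a≤m inj-τ = refl
inv-blow {m} τ ε (suc a) a<m inj-τ = begin
  inv β A + gt β A (β A) + (gt β A (β (suc A)) + ind (β (suc A)) (β A))
    ≡⟨ cong₂ (λ y z → inv β A + gt β A y + (gt β A z + ind z y)) (blow-even τ ε a) (blow-odd τ ε a) ⟩
  inv β A + gt β A (dig t e) + (gt β A (dig t (not e)) + ind (dig t (not e)) (dig t e))
    ≡⟨ cong₂ _+_ (cong₂ _+_ (inv-blow τ ε a (<⇒≤ a<m) inj-τ) (gt-blow τ ε a t e ne))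
                 (cong₂ _+_ (gt-blow τ ε a t (not e) ne) (ind-dig-not t e)) ⟩
  4 * inv τ a + tot ε a + (g + g) + (g + g + χ e) ≡⟨ lem (inv τ a) (tot ε a) g (χ e) ⟩
  4 * (inv τ a + g) + (tot ε a + χ e) ∎
  where
  open ≡-Reasoning
  β = blow τ ε
  A = dbl a
  t = τ a
  e = ε a
  g = gt τ a t
  ne : ∀ x → x < a → t ≢ τ x
  ne x x<a p = <⇒≢ x<a (inj-τ x a (<-trans x<a a<m) a<m (sym p))
  lem : ∀ i s g c → 4 * i + s + (g + g) + (g + g + c) ≡ 4 * (i + g) + (s + c)
  lem = solve-∀

-- The order on codes

-- A Wachs word on 2m+1 letters: the order τ of the m blocks, which blocks are
-- reversed, and the number p of blocks in front of the largest letter.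
-- Words on 2m letters are those with p = m.
record Code (m : ℕ) : Set where
  field
    τ    : ℕ → ℕ
    ε    : ℕ → Bool
    p    : ℕ
    p≤m  : p ≤ m
    perm : Perm m τ
open Code public

record Encodes {m : ℕ} (c : Code m) (w : ℕ → ℕ) : Set where
  field
    top  : w (dbl (p c)) ≡ dbl m
    rest : ∀ x → x < dbl m → w (skip (dbl (p c)) x) ≡ blow (τ c) (ε c) x
open Encodes public

module _ {m : ℕ} {c : Code m} {w : ℕ → ℕ} (enc : Encodes c w) where

  private
    q = dbl (p c)

  q≤2m : q ≤ dbl m
  q≤2m = dbl-mono (p≤m c)

  cnt-left : ∀ a B → a ≤ q → cnt w a B ≡ cnt (blow (τ c) (ε c)) a B
  cnt-left a B a≤q = trans (cnt-skip-≤ w q a B a≤q)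
    (cnt-cong a B (λ x x<a → rest enc x (<-≤-trans x<a (≤-trans a≤q q≤2m))))

  cnt-right : ∀ a B → q ≤ a → a ≤ dbl m → B ≤ dbl m → cnt w (suc a) B ≡ cnt (blow (τ c) (ε c)) a B
  cnt-right a B q≤a a≤ B≤ = begin
    cnt w (suc a) B                          ≡⟨ cnt-skip-> w q a B q≤a ⟩
    cnt (w ∘ skip q) a B + ind (w q) B       ≡⟨ cong₂ _+_ (cnt-cong a B (λ x x<a → rest enc x (<-≤-trans x<a a≤)))
                                                  (trans (cong (λ z → ind z B) (top enc)) (ind-≥ B≤)) ⟩
    cnt (blow (τ c) (ε c)) a B + 0           ≡⟨ +-identityʳ _ ⟩
    cnt (blow (τ c) (ε c)) a B               ∎
    where open ≡-Reasoning

  rest-< : ∀ x → x < dbl m → w (skip q x) < dbl m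
  rest-< x x< = subst (_< dbl m) (sym (rest enc x x<)) (blow-< (ε c) (bound (perm c)) x x<)

  encodes-perm : Perm (suc (dbl m)) w
  encodes-perm = record { bound = bd ; inj = ij }
    where
    bd : ∀ x → x < suc (dbl m) → w x < suc (dbl m)
    bd x x< with unskip q x
    ... | inj₁ refl       = s≤s (≤-reflexive (top enc))
    ... | inj₂ (y , refl) = m<n⇒m<1+n (rest-< y (skip-<⁻ y q≤2m x<))
    ij : Inj< (suc (dbl m)) w
    ij x y x< y< e with unskip q x | unskip q y
    ... | inj₁ refl | inj₁ refl = refl
    ... | inj₁ refl | inj₂ (z , refl) =
      contradiction (trans (sym e) (top enc)) (<⇒≢ (rest-< z (skip-<⁻ z q≤2m y<)))
    ... | inj₂ (z , refl) | inj₁ refl =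
      contradiction (trans e (top enc)) (<⇒≢ (rest-< z (skip-<⁻ z q≤2m x<)))
    ... | inj₂ (y′ , refl) | inj₂ (z , refl) = cong (skip q) (blow-inj (ε c) (inj (perm c)) y′ z y′< z<
        (trans (sym (rest enc y′ y′<)) (trans e (rest enc z z<))))
      where
      y′< : y′ < dbl m
      y′< = skip-<⁻ y′ q≤2m x<
      z< : z < dbl m
      z< = skip-<⁻ z q≤2m y<

  inv-encoded : inv w (suc (dbl m)) ≡ 4 * inv (τ c) m + tot (ε c) m + (dbl m ∸ q)
  inv-encoded = trans
    (inv-skip w q (dbl m) q≤2m (λ x x< → subst (w (skip q x) <_) (sym (top enc)) (rest-< x x<)))
    (cong (_+ (dbl m ∸ q)) (trans (inv-cong (dbl m) (rest enc)) (inv-blow (τ c) (ε c) m ≤-refl (inj (perm c)))))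

encodes-unique : ∀ {m} {c : Code m} {u v} → Encodes c u → Encodes c v →
  ∀ x → x < suc (dbl m) → u x ≡ v x
encodes-unique {m} {c} eu ev x x< with unskip (dbl (p c)) x
... | inj₁ refl       = trans (top eu) (sym (top ev))
... | inj₂ (y , refl) = trans (rest eu y y<) (sym (rest ev y y<))
  where
  y< : y < dbl m
  y< = skip-<⁻ y (q≤2m eu) x<

-- A block a with `p c′ ≤ a < p c` has n on different sides in the two words. Its rows are then
-- shifted by one against each other, so its centre is never compared with its own centre, and
-- `stuck` asks nothing of it.
record _⊑_ {m : ℕ} (c c′ : Code m) : Set where
  field
    dom   : Dom m (τ c) (τ c′)
    p≥    : p c′ ≤ p c
    stuck : ∀ a → a < m → a < p c′ ⊎ p c ≤ a → Stuck≤ (τ c) (τ c′) (ε c) (ε c′) a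
open _⊑_ public

⊑⇒Dom : ∀ {m} {c c′ : Code m} {u v} → Encodes c u → Encodes c′ v → c ⊑ c′ → Dom (suc (dbl m)) u v
⊑⇒Dom {m} {c} {c′} {u} {v} eu ev le a B a≤ B≤ with m≤n⇒m<n∨m≡n B≤
... | inj₂ refl = ≤-trans (cnt≤ v a B) (≤-reflexive (sym (cnt-full u a B
        -- In the last column every letter is counted, so u attains the largest possible count.
        (λ x x<a → bound (encodes-perm eu) x (<-≤-trans x<a a≤)))))
... | inj₁ B<s = go a a≤
  where
  B≤2m : B ≤ dbl m
  B≤2m = s≤s⁻¹ B<s
  β = blow (τ c) (ε c)
  β′ = blow (τ c′) (ε c′)
  same : ∀ a → a ≤ dbl m → (∀ k → a ≡ suc (dbl k) → k < p c′ ⊎ p c ≤ k) → cnt β′ a B ≤ cnt β a B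
  same a a≤ side with evenOrOdd a
  ... | inj₁ (k , refl) = blow-Dom-even (ε c) (ε c′) (dom le) k B (dbl-cancel-≤ a≤) B≤2m
  ... | inj₂ (k , refl) = blow-Dom-odd (dom le) k B k<m B≤2m (stuck le k k<m (side k refl))
    where
    k<m : k < m
    k<m = dbl-cancel-< a≤
  -- After n has appeared in v but not in u, row a of β′ meets row a + 1 of β. One of these rows is
  -- even, where ε does not enter; monotonicity in the row bridges the other.
  between′ : ∀ a → suc a ≤ dbl m → cnt β′ a B ≤ cnt β (suc a) B
  between′ a a< with evenOrOdd a
  ... | inj₁ (k , refl) = ≤-trans
    (blow-Dom-even (ε c) (ε c′) (dom le) k B (dbl-cancel-≤ (<⇒≤ a<)) B≤2m) (m≤m+n _ _)
  ... | inj₂ (k , refl) = ≤-trans (m≤m+n _ _)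
    (blow-Dom-even (ε c) (ε c′) (dom le) (suc k) B (dbl-cancel-≤ a<) B≤2m)
  go : ∀ a → a ≤ suc (dbl m) → cnt v a B ≤ cnt u a B
  go zero    _  = z≤n
  go (suc a) a≤ with <-≤-connex a (dbl (p c′)) | <-≤-connex a (dbl (p c))
  ... | inj₁ l | inj₁ r = subst₂ _≤_ (sym (cnt-left ev (suc a) B l)) (sym (cnt-left eu (suc a) B r))
    (same (suc a) (≤-trans r (q≤2m eu)) (λ { k refl → inj₁ (dbl-cancel-< l) }))
  ... | inj₁ l | inj₂ r = contradiction (≤-trans (dbl-mono (p≥ le)) r) (<⇒≱ l)
  ... | inj₂ l | inj₁ r = subst₂ _≤_ (sym (cnt-right ev a B l (s≤s⁻¹ a≤) B≤2m)) (sym (cnt-left eu (suc a) B r))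
    (between′ a (≤-trans r (q≤2m eu)))
  ... | inj₂ l | inj₂ r = subst₂ _≤_ (sym (cnt-right ev a B l (s≤s⁻¹ a≤) B≤2m)) (sym (cnt-right eu a B r (s≤s⁻¹ a≤) B≤2m))
    (same a (s≤s⁻¹ a≤) (λ { k refl → inj₂ (s≤s⁻¹ (dbl-cancel-< (s≤s r))) }))

-- Parity absorbs an error of one. This is what makes the comparison of τ and τ′ recoverable in rows
-- where n is present in only one of the words.
dbl-reflects-≤ : ∀ x y → x + x ≤ suc (y + y) → x ≤ y
dbl-reflects-≤ x y le with <-≤-connex y x
... | inj₂ p = p
... | inj₁ p = contradiction (≤-trans (≤-reflexive (cong suc (sym (+-suc y y)))) (+-mono-≤ p p)) (<⇒≱ (s≤s le))

Dom⇒⊑ : ∀ {m} {c c′ : Code m} {u v} → Encodes c u → Encodes c′ v → Dom (suc (dbl m)) u v → c ⊑ c′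
Dom⇒⊑ {m} {c} {c′} {u} {v} eu ev d = record { dom = dm ; p≥ = ple ; stuck = st }
  where
  β = blow (τ c) (ε c)
  β′ = blow (τ c′) (ε c′)

  ple : p c′ ≤ p c
  ple with <-≤-connex (p c) (p c′)
  ... | inj₂ r = r
  -- If n stood further left in u, then among the first 2p + 1 letters, with p = `p c`, all those of
  -- v would be below 2m, but at most 2p of those of u.
  ... | inj₁ r = contradiction
    (subst₂ _≤_ (trans (cnt-left ev (suc q) (dbl m) q<)
                   (cnt-full β′ (suc q) (dbl m) (λ x x< → blow-< (ε c′) (bound (perm c′)) x (<-≤-trans x< (≤-trans q< (q≤2m ev))))))
                (cnt-right eu q (dbl m) ≤-refl (q≤2m eu) ≤-refl)
                (d (suc q) (dbl m) (s≤s (q≤2m eu)) (n≤1+n _)))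
    (<⇒≱ (s≤s (cnt≤ β q (dbl m))))
    where
    q = dbl (p c)
    q< : suc q ≤ dbl (p c′)
    q< = ≤-trans (n≤1+n _) (dbl-mono r)

  left : ∀ a B → a ≤ dbl (p c′) → B ≤ dbl m → cnt β′ a B ≤ cnt β a B
  left a B a≤ B≤ = subst₂ _≤_ (cnt-left ev a B a≤) (cnt-left eu a B (≤-trans a≤ (dbl-mono ple)))
    (d a B (≤-trans (≤-trans a≤ (q≤2m ev)) (n≤1+n _)) (≤-trans B≤ (n≤1+n _)))

  right : ∀ a B → dbl (p c) ≤ a → a ≤ dbl m → B ≤ dbl m → cnt β′ a B ≤ cnt β a B
  right a B ≤a a≤ B≤ = subst₂ _≤_ (cnt-right ev a B (≤-trans (dbl-mono ple) ≤a) a≤ B≤) (cnt-right eu a B ≤a a≤ B≤)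
    (d (suc a) B (s≤s a≤) (≤-trans B≤ (n≤1+n _)))

  even : ∀ a b → cnt β′ (dbl a) (dbl b) ≤ cnt β (dbl a) (dbl b) → cnt (τ c′) a b ≤ cnt (τ c) a b
  even a b h = dbl-reflects-≤ _ _ (≤-trans (subst₂ _≤_ (cnt-blow-00 (τ c′) (ε c′) a b) (cnt-blow-00 (τ c) (ε c) a b) h) (n≤1+n _))

  -- Here n is among the first 2a + 2 letters of v but not of u, so the second letter of block a is
  -- missing from the count for v. This costs at most one.
  mid : ∀ a b → suc a ≤ p c → p c′ ≤ a → b ≤ m → cnt (τ c′) (suc a) b ≤ cnt (τ c) (suc a) b
  mid a b a<p p′≤a b≤m = dbl-reflects-≤ _ _ (begin
    cnt τ′ (suc a) b + cnt τ′ (suc a) b         ≤⟨ +-monoˡ-≤ (cnt τ′ (suc a) b) (+-monoʳ-≤ (cnt τ′ a b) (ind≤1 (τ′ a) b)) ⟩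
    cnt τ′ a b + 1 + cnt τ′ (suc a) b           ≡⟨ lem (cnt τ′ a b) _ ⟩
    suc (cnt τ′ a b + cnt τ′ (suc a) b)         ≡⟨ cong suc (sym (cnt-blow-10 τ′ (ε c′) a b)) ⟩
    suc (cnt β′ (suc (dbl a)) (dbl b))          ≡⟨ cong suc (sym (cnt-right ev (suc (dbl a)) (dbl b)
                                                     (≤-trans (dbl-mono p′≤a) (n≤1+n _)) (≤-trans (n≤1+n _) a≤) b≤)) ⟩
    suc (cnt v (dbl (suc a)) (dbl b))           ≤⟨ s≤s (d (dbl (suc a)) (dbl b) (≤-trans a≤ (n≤1+n _)) (≤-trans b≤ (n≤1+n _))) ⟩
    suc (cnt u (dbl (suc a)) (dbl b))           ≡⟨ cong suc (cnt-left eu (dbl (suc a)) (dbl b) (dbl-mono a<p)) ⟩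
    suc (cnt β (dbl (suc a)) (dbl b))           ≡⟨ cong suc (cnt-blow-00 (τ c) (ε c) (suc a) b) ⟩
    suc (cnt (τ c) (suc a) b + cnt (τ c) (suc a) b) ∎)
    where
    open ≤-Reasoning
    τ′ = τ c′
    a≤ : dbl (suc a) ≤ dbl m
    a≤ = dbl-mono (≤-trans a<p (p≤m c))
    b≤ : dbl b ≤ dbl m
    b≤ = dbl-mono b≤m
    lem : ∀ a b → a + 1 + b ≡ suc (a + b)
    lem = solve-∀

  dm : Dom m (τ c) (τ c′)
  dm zero    b a≤m b≤m = z≤n
  dm (suc a) b a≤m b≤m with <-≤-connex a (p c′) | <-≤-connex a (p c)
  ... | inj₁ l | _      = even (suc a) b (left (dbl (suc a)) (dbl b) (dbl-mono l) (dbl-mono b≤m))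
  ... | inj₂ l | inj₁ r = mid a b r l b≤m
  ... | inj₂ l | inj₂ r = even (suc a) b (right (dbl (suc a)) (dbl b) (≤-trans (dbl-mono r) (≤-trans (n≤1+n _) (n≤1+n _))) (dbl-mono a≤m) (dbl-mono b≤m))

  st : ∀ a → a < m → a < p c′ ⊎ p c ≤ a → Stuck≤ (τ c) (τ c′) (ε c) (ε c′) a
  st a a<m side = center⇒Stuck≤ {ε = ε c} {ε c′} a (pick side)
    where
    b = τ c a
    B≤ : suc (dbl b) ≤ dbl m
    B≤ = ≤-trans (n≤1+n _) (dbl-mono (bound (perm c) a a<m))
    pick : a < p c′ ⊎ p c ≤ a → center (τ c′) (ε c′) a b ≤ center (τ c) (ε c) a b
    pick (inj₁ l) = left (suc (dbl a)) (suc (dbl b)) (≤-trans (n≤1+n _) (dbl-mono l)) B≤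
    pick (inj₂ r) = right (suc (dbl a)) (suc (dbl b)) (≤-trans (dbl-mono r) (n≤1+n _))
                      (≤-trans (n≤1+n _) (dbl-mono a<m)) B≤

-- The elementary moves and interpolation

wlen : ∀ {m} → Code m → ℕ
wlen {m} c = 3 * inv (τ c) m + tot (ε c) m + 2 * (m ∸ p c)

set : (ℕ → Bool) → ℕ → Bool → ℕ → Bool
set ε a e x with x ≟ a
... | yes _ = e
... | no _  = ε x

set-at : ∀ ε a e → set ε a e a ≡ e
set-at ε a e with a ≟ a
... | yes _ = refl
... | no ne = contradiction refl ne

set-other : ∀ ε {a x} e → x ≢ a → set ε a e x ≡ ε x
set-other ε {a} {x} e ne with x ≟ a
... | yes p = contradiction p ne
... | no _  = refl

tot-cong : ∀ {ε ε′} a → (∀ x → x < a → ε x ≡ ε′ x) → tot ε a ≡ tot ε′ a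
tot-cong zero    h = refl
tot-cong (suc a) h = cong₂ (λ s e → s + χ e) (tot-cong a (λ x p → h x (m<n⇒m<1+n p))) (h a ≤-refl)

tot-set : ∀ ε {a m} e → a < m → tot (set ε a e) m + χ (ε a) ≡ tot ε m + χ e
tot-set ε {a} {suc m} e a≤m with m≤n⇒m<n∨m≡n (s≤s⁻¹ a≤m)
... | inj₂ refl = begin
  tot (set ε a e) a + χ (set ε a e a) + χ (ε a) ≡⟨ cong₂ (λ s d → s + χ d + χ (ε a)) (tot-cong a (λ x x<a → set-other ε e (<⇒≢ x<a))) (set-at ε a e) ⟩
  tot ε a + χ e + χ (ε a)                       ≡⟨ lem (tot ε a) _ _ ⟩
  tot ε a + χ (ε a) + χ e                       ∎
  where
  open ≡-Reasoning
  lem : ∀ a b c → a + b + c ≡ a + c + b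
  lem = solve-∀
... | inj₁ a<m = begin
  tot (set ε a e) m + χ (set ε a e m) + χ (ε a) ≡⟨ cong (λ d → tot (set ε a e) m + χ d + χ (ε a)) (set-other ε e (>⇒≢ a<m)) ⟩
  tot (set ε a e) m + χ (ε m) + χ (ε a)         ≡⟨ lem (tot (set ε a e) m) _ _ ⟩
  tot (set ε a e) m + χ (ε a) + χ (ε m)         ≡⟨ cong (_+ χ (ε m)) (tot-set ε e a<m) ⟩
  tot ε m + χ e + χ (ε m)                       ≡⟨ lem (tot ε m) _ _ ⟩
  tot ε m + χ (ε m) + χ e                       ∎
  where
  open ≡-Reasoning
  lem : ∀ a b c → a + b + c ≡ a + c + b
  lem = solve-∀

-- `p-or` keeps the intermediate code inside words on n letters: for n = 2m both ends have p = m,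
-- which excludes the second alternative and forces p = m on `d`.
record Between {m : ℕ} (c c′ : Code m) : Set where
  field
    d     : Code m
    c⊑d   : c ⊑ d
    d⊑c′  : d ⊑ c′
    wlen≡ : wlen d ≡ suc (wlen c)
    p-or  : p d ≡ p c ⊎ p c′ < p c

module _ {m : ℕ} {c c′ : Code m} (le : c ⊑ c′) where

  -- τ and p stay and ε only grows, so `d` is above c at once. Against c′ only block a can cause
  -- trouble, and `free` is the condition that it does not.
  flipUp : ∀ a → a < m → ε c a ≡ false →
    (a < p c′ ⊎ p c ≤ a → τ c a ≡ τ c′ a → ε c′ a ≡ true ⊎ base (τ c′) a (τ c a) < base (τ c) a (τ c a)) →
    Between c c′
  flipUp a a<m εa free = record
    { d     = d
    ; c⊑d   = record { dom = Dom-refl {u = τ c} ; p≥ = ≤-refl ; stuck = λ x _ _ _ → inj₁ (up x) }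
    ; d⊑c′  = record { dom = dom le ; p≥ = p≥ le ; stuck = st }
    ; wlen≡ = trans (cong (λ t → 3 * inv (τ c) m + t + 2 * (m ∸ p c)) tot≡) (lem (inv (τ c) m) (tot (ε c) m) (m ∸ p c))
    ; p-or  = inj₁ refl }
    where
    d : Code m
    d = record c { ε = set (ε c) a true }
    up : ∀ x → χ (ε c x) ≤ χ (set (ε c) a true x)
    up x with x ≟ a
    ... | yes _ = χ≤1 (ε c x)
    ... | no _  = ≤-refl
    st : ∀ x → x < m → x < p c′ ⊎ p c ≤ x → Stuck≤ (τ c) (τ c′) (set (ε c) a true) (ε c′) x
    st x x<m side e with x ≟ a
    ... | no _ = stuck le x x<m side e
    ... | yes refl with free side e
    ...   | inj₁ t = inj₁ (≤-reflexive (cong χ (sym t)))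
    ...   | inj₂ lt = inj₂ lt
    tot≡ : tot (set (ε c) a true) m ≡ suc (tot (ε c) m)
    tot≡ = trans (sym (+-identityʳ _)) (trans (cong (λ e → tot (set (ε c) a true) m + χ e) (sym εa))
             (trans (tot-set (ε c) true a<m) (+-comm _ 1)))
    lem : ∀ i t q → 3 * i + suc t + 2 * q ≡ suc (3 * i + t + 2 * q)
    lem = solve-∀

  -- Block a stands directly before n in c and directly after it in `d`, so it changes sides and its
  -- bit may drop. Being unreversed in `d`, it then meets every demand of c′. The balance is 2 - 1.
  moveTop : ∀ a → a < p c → p c′ ≤ a → p c ≡ suc a → ε c a ≡ true → Between c c′
  moveTop a a<p p′≤a pc≡ εa = record
    { d     = d
    ; c⊑d   = record { dom = Dom-refl {u = τ c} ; p≥ = <⇒≤ a<p ; stuck = st₁ }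
    ; d⊑c′  = record { dom = dom le ; p≥ = p′≤a ; stuck = st₂ }
    ; wlen≡ = wl
    ; p-or  = inj₂ (≤-<-trans p′≤a a<p) }
    where
    a<m : a < m
    a<m = <-≤-trans a<p (p≤m c)
    d : Code m
    d = record { τ = τ c ; ε = set (ε c) a false ; p = a ; p≤m = <⇒≤ a<m ; perm = perm c }
    st₁ : ∀ x → x < m → x < a ⊎ p c ≤ x → Stuck≤ (τ c) (τ c) (ε c) (set (ε c) a false) x
    st₁ x _ side _ = inj₁ (≤-reflexive (cong χ (sym (set-other (ε c) false (x≢a side)))))
      where
      x≢a : x < a ⊎ p c ≤ x → x ≢ a
      x≢a (inj₁ l) = <⇒≢ l
      x≢a (inj₂ r) = >⇒≢ (<-≤-trans a<p r)
    st₂ : ∀ x → x < m → x < p c′ ⊎ a ≤ x → Stuck≤ (τ c) (τ c′) (set (ε c) a false) (ε c′) x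
    st₂ x x<m side e with x ≟ a
    ... | yes _ = inj₁ z≤n
    ... | no x≢a = stuck le x x<m (side′ side) e
      where
      side′ : x < p c′ ⊎ a ≤ x → x < p c′ ⊎ p c ≤ x
      side′ (inj₁ l) = inj₁ l
      side′ (inj₂ r) = inj₂ (subst (_≤ x) (sym pc≡) (≤∧≢⇒< r (x≢a ∘ sym)))
    tot≡ : suc (tot (set (ε c) a false) m) ≡ tot (ε c) m
    tot≡ = trans (+-comm 1 _) (trans (cong (λ e → tot (set (ε c) a false) m + χ e) (sym εa))
             (trans (tot-set (ε c) false a<m) (+-identityʳ _)))
    m∸a : m ∸ a ≡ suc (m ∸ p c)
    m∸a = trans (∸-suc a<m) (cong (λ k → suc (m ∸ k)) (sym pc≡))
      where
      ∸-suc : ∀ {k n} → k < n → n ∸ k ≡ suc (n ∸ suc k)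
      ∸-suc {zero}  {suc n} _       = refl
      ∸-suc {suc k} {suc n} (s≤s r) = ∸-suc r
    lem : ∀ i t q → 3 * i + t + 2 * suc q ≡ suc (3 * i + suc t + 2 * q)
    lem = solve-∀
    wl : wlen d ≡ suc (wlen c)
    wl = begin
      3 * I + T + 2 * (m ∸ a)               ≡⟨ cong (λ k → 3 * I + T + 2 * k) m∸a ⟩
      3 * I + T + 2 * suc (m ∸ p c)         ≡⟨ lem I T (m ∸ p c) ⟩
      suc (3 * I + suc T + 2 * (m ∸ p c))   ≡⟨ cong (λ t → suc (3 * I + t + 2 * (m ∸ p c))) tot≡ ⟩
      suc (wlen c)                          ∎
      where
      open ≡-Reasoning
      I = inv (τ c) m
      T = tot (set (ε c) a false) m

  -- Blocks i and j hold other letters in `d` than in c, so their bits may drop, and once they are 0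
  -- they meet every demand of c′. What is left to check is that the gaps which protect the other
  -- blocks survive the swap. The balance is 3 - 2.
  swapBlocks : (cs : CoverSwap m (τ c) (τ c′)) → let open CoverSwap cs in
    ε c i ≡ true → ε c j ≡ true → Between c c′
  swapBlocks cs εi εj = record
    { d     = d
    ; c⊑d   = record { dom = sw-Dom (τ c) i<j ui<uj ; p≥ = ≤-refl ; stuck = st₁ }
    ; d⊑c′  = record { dom = below ; p≥ = p≥ le ; stuck = st₂ }
    ; wlen≡ = wl
    ; p-or  = inj₁ refl }
    where
    open CoverSwap cs
    i<m : i < m
    i<m = <-trans i<j j<n
    ρ = sw (τ c) i j
    ε₁ = set (ε c) i false
    ε₂ = set ε₁ j false
    d : Code m
    d = record { τ = ρ ; ε = ε₂ ; p = p c ; p≤m = p≤m c ; perm = sw-perm i<m j<n (perm c) }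
    ε₂-other : ∀ {x} → x ≢ i → x ≢ j → ε₂ x ≡ ε c x
    ε₂-other ni nj = trans (set-other ε₁ false nj) (set-other (ε c) false ni)
    st₁ : ∀ x → x < m → x < p c ⊎ p c ≤ x → Stuck≤ (τ c) ρ (ε c) ε₂ x
    st₁ x x<m _ e = go (x ≟ i) (x ≟ j)
      where
      go : Dec (x ≡ i) → Dec (x ≡ j) → χ (ε c x) ≤ χ (ε₂ x) ⊎ base ρ x (τ c x) < base (τ c) x (τ c x)
      go (yes refl) _       = contradiction (trans e (sw-i (τ c) i j)) (<⇒≢ ui<uj)
      go (no _) (yes refl)  = contradiction (sym (trans e (sw-j (τ c) i j))) (<⇒≢ ui<uj)
      go (no ni) (no nj)    = inj₁ (≤-reflexive (cong χ (sym (ε₂-other ni nj))))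
    st₂ : ∀ x → x < m → x < p c′ ⊎ p c ≤ x → Stuck≤ ρ (τ c′) ε₂ (ε c′) x
    st₂ x x<m side e = go (x ≟ i) (x ≟ j)
      where
      go : Dec (x ≡ i) → Dec (x ≡ j) → χ (ε₂ x) ≤ χ (ε c′ x) ⊎ base (τ c′) x (ρ x) < base ρ x (ρ x)
      go (yes refl) _ = inj₁ (≤-trans (≤-reflexive (cong χ (trans (set-other ε₁ false (<⇒≢ i<j)) (set-at (ε c) i false)))) z≤n)
      go (no _) (yes refl) = inj₁ (≤-trans (≤-reflexive (cong χ (set-at ε₁ j false))) z≤n)
      go (no ni) (no nj) with stuck le x x<m side (trans (sym ρx) e)
        where
        ρx : ρ x ≡ τ c x
        ρx = sw-other (τ c) ni nj
      ... | inj₁ l = inj₁ (subst (λ b → χ b ≤ χ (ε c′ x)) (sym (ε₂-other ni nj)) l)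
      ... | inj₂ l = inj₂ (subst (λ b → base (τ c′) x b < base ρ x b) (sym ρx)
                           (subst (base (τ c′) x t <_) (sym base≡) l))
        where
        t = τ c x
        ρx : ρ x ≡ t
        ρx = sw-other (τ c) ni nj
        t≢ui : t ≢ τ c i
        t≢ui h = ni (inj (perm c) x i x<m i<m h)
        t≢uj : t ≢ τ c j
        t≢uj h = nj (inj (perm c) x j x<m j<n h)
        base≡ : base ρ x t ≡ base (τ c) x t
        -- The swap alters counts only in the rectangle spanned by rows i, j and columns `τ c i`,
        -- `τ c j`. One of the two entries of `base` at the dot of x falls into it only if the dot
        -- lies strictly inside, which `empty` forbids.
        base≡ = cong₂ _+_
          (cnt-sw-outside (τ c) i<j ui<uj (suc x) t λ (i≤x , x<j , ui<t , t≤uj) →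
            empty x (≤∧≢⇒< (s≤s⁻¹ i≤x) (ni ∘ sym)) x<j ui<t (≤∧≢⇒< t≤uj t≢uj))
          (cnt-sw-outside (τ c) i<j ui<uj x (suc t) λ (i<x , x≤j , ui≤t , t<uj) →
            empty x i<x (≤∧≢⇒< x≤j nj) (≤∧≢⇒< (s≤s⁻¹ ui≤t) (t≢ui ∘ sym)) t<uj)
    tot₁ : suc (tot ε₁ m) ≡ tot (ε c) m
    tot₁ = trans (+-comm 1 _) (trans (cong (λ e → tot ε₁ m + χ e) (sym εi))
             (trans (tot-set (ε c) false i<m) (+-identityʳ _)))
    tot₂ : suc (tot ε₂ m) ≡ tot ε₁ m
    tot₂ = trans (+-comm 1 _) (trans (cong (λ e → tot ε₂ m + χ e) (sym (trans (set-other (ε c) false (>⇒≢ i<j)) εj)))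
             (trans (tot-set ε₁ false j<n) (+-identityʳ _)))
    lem : ∀ i t q → 3 * suc i + t + 2 * q ≡ suc (3 * i + suc (suc t) + 2 * q)
    lem = solve-∀
    wl : wlen d ≡ suc (wlen c)
    wl = begin
      3 * inv ρ m + tot ε₂ m + 2 * Q            ≡⟨ cong (λ k → 3 * k + tot ε₂ m + 2 * Q)
                                                     (inv-sw-cover (τ c) (inj (perm c)) i<j j<n ui<uj empty) ⟩
      3 * suc I + tot ε₂ m + 2 * Q              ≡⟨ lem I (tot ε₂ m) Q ⟩
      suc (3 * I + suc (suc (tot ε₂ m)) + 2 * Q) ≡⟨ cong (λ t → suc (3 * I + t + 2 * Q)) (trans (cong suc tot₂) tot₁) ⟩
      suc (wlen c)                              ∎
      where
      open ≡-Reasoning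
      I = inv (τ c) m
      Q = m ∸ p c

record _≈_ {m : ℕ} (c c′ : Code m) : Set where
  field
    τ≈ : ∀ x → x < m → τ c x ≡ τ c′ x
    ε≈ : ∀ x → x < m → ε c x ≡ ε c′ x
    p≈ : p c ≡ p c′

blow-cong : ∀ {m τ τ′ ε ε′} → (∀ x → x < m → τ x ≡ τ′ x) → (∀ x → x < m → ε x ≡ ε′ x) →
  ∀ x → x < dbl m → blow τ ε x ≡ blow τ′ ε′ x
blow-cong {m} {τ} {τ′} {ε} {ε′} eτ eε x x< with evenOrOdd x
... | inj₁ (a , refl) = trans (blow-even τ ε a) (trans (cong₂ dig (eτ a a<m) (eε a a<m)) (sym (blow-even τ′ ε′ a)))
  where
  a<m : a < m
  a<m = dbl-cancel-< x<
... | inj₂ (a , refl) = trans (blow-odd τ ε a) (trans (cong₂ (λ t e → dig t (not e)) (eτ a a<m) (eε a a<m)) (sym (blow-odd τ′ ε′ a)))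
  where
  a<m : a < m
  a<m = dbl-cancel-< (<⇒≤ x<)

encodes-≈ : ∀ {m} {c c′ : Code m} {w} → c ≈ c′ → Encodes c w → Encodes c′ w
encodes-≈ {m} {c} {c′} {w} record { τ≈ = τ≈ ; ε≈ = ε≈ ; p≈ = p≈ } enc = record
  { top  = subst (λ q → w (dbl q) ≡ dbl m) p≈ (top enc)
  ; rest = λ x x< → subst (λ q → w (skip (dbl q) x) ≡ blow (τ c′) (ε c′) x) p≈
                      (trans (rest enc x x<) (blow-cong τ≈ ε≈ x x<)) }

-- τ is corrected before p, and p before ε. When a swap or a move of n is due but a block involved
-- is unreversed, that block is unconstrained and is reversed instead. Once τ and p agree no gap is
-- left, so every remaining difference in ε is an unreversed block of c that is reversed in c′.
interpolate : ∀ {m} {c c′ : Code m} → c ⊑ c′ → c ≈ c′ ⊎ Between c c′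
interpolate {m} {c} {c′} le with coverSwap (perm c) (perm c′) (dom le)
... | inj₂ cs = inj₂ (swapCase (ε c i) refl (ε c j) refl)
  where
  open CoverSwap cs
  swapCase : ∀ ei → ε c i ≡ ei → ∀ ej → ε c j ≡ ej → Between c c′
  swapCase false εi _ _ = flipUp le i (<-trans i<j j<n) εi (λ _ e → contradiction e ui≢vi)
  -- At a common dot of row j, that row adds nothing to column `τ c j`, so `strict` passes to the
  -- first summand of `base`; the second is bounded by `dom`.
  swapCase true εi false εj = flipUp le j j<n εj λ _ e → inj₂ (+-mono-<-≤
    (subst₂ _<_ (sym (trans (cong (cnt (τ c′) j (τ c j) +_) (ind-≥ (≤-reflexive e))) (+-identityʳ _)))
                (sym (trans (cong (cnt (τ c) j (τ c j) +_) (ind-≥ {τ c j} ≤-refl)) (+-identityʳ _)))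
                strict)
    (dom le j (suc (τ c j)) (<⇒≤ j<n) (bound (perm c) j j<n)))
  swapCase true εi true εj = swapBlocks le cs εi εj
... | inj₁ τ≈ with m≤n⇒m<n∨m≡n (p≥ le)
...   | inj₁ p′<p = inj₂ (topCase (p c) refl)
  where
  topCase : ∀ q → p c ≡ q → Between c c′
  topCase zero    e = contradiction (subst (p c′ <_) e p′<p) λ ()
  topCase (suc a) e = go (ε c a) refl
    where
    a<p : a < p c
    a<p = ≤-reflexive (sym e)
    p′≤a : p c′ ≤ a
    p′≤a = s≤s⁻¹ (subst (p c′ <_) e p′<p)
    -- Block a, the last one before n in c, is behind n in c′, so it cannot be stuck.
    out : ¬ (a < p c′ ⊎ p c ≤ a)
    out (inj₁ l) = <⇒≱ l p′≤a
    out (inj₂ r) = <⇒≱ a<p r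
    go : ∀ ea → ε c a ≡ ea → Between c c′
    go false εa = flipUp le a (<-≤-trans a<p (p≤m c)) εa (λ side _ → contradiction side out)
    go true  εa = moveTop le a a<p p′≤a e εa
...   | inj₂ p≡ with least (λ x → ¬? (ε c x Bool.≟ ε c′ x)) m
...     | inj₁ none = inj₁ record { τ≈ = τ≈ ; ε≈ = ε≈ ; p≈ = sym p≡ }
  where
  ε≈ : ∀ x → x < m → ε c x ≡ ε c′ x
  ε≈ x x<m with ε c x Bool.≟ ε c′ x
  ... | yes e = e
  ... | no ne = contradiction ne (none x x<m)
...     | inj₂ (a , a<m , ne , _) = inj₂ (go (ε c a) refl (ε c′ a) refl)
  where
  side : a < p c′ ⊎ p c ≤ a
  side with <-≤-connex a (p c′)
  ... | inj₁ l = inj₁ l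
  ... | inj₂ r = inj₂ (subst (_≤ a) p≡ r)
  base≡ : base (τ c′) a (τ c a) ≡ base (τ c) a (τ c a)
  base≡ = cong₂ _+_ (cnt-cong (suc a) _ (λ x x≤a → sym (τ≈ x (<-≤-trans x≤a a<m))))
                    (cnt-cong a _ (λ x x<a → sym (τ≈ x (<-trans x<a a<m))))
  go : ∀ e → ε c a ≡ e → ∀ e′ → ε c′ a ≡ e′ → Between c c′
  go false p true q = flipUp le a a<m p (λ _ _ → inj₁ q)
  go false p false q = contradiction (trans p (sym q)) ne
  go true p true q = contradiction (trans p (sym q)) ne
  go true p false q with stuck le a a<m side (τ≈ a a<m)
  ... | inj₁ l = contradiction (subst₂ (λ d e → χ d ≤ χ e) p q l) λ ()
  ... | inj₂ l = contradiction (subst (_< base (τ c) a (τ c a)) base≡ l) (<-irrefl refl)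

-- Encoding and decoding Wachs permutations

Size : ℕ → ℕ → Set
Size n m = n ≡ dbl m ⊎ n ≡ suc (dbl m)

Fits : ∀ {m} → ℕ → Code m → Set
Fits {m} n c = (n ≡ dbl m × p c ≡ m) ⊎ n ≡ suc (dbl m)

fits-size : ∀ {m n} {c : Code m} → Fits n c → Size n m
fits-size (inj₁ (e , _)) = inj₁ e
fits-size (inj₂ e)       = inj₂ e

size-≤ : ∀ {n m} → Size n m → n ≤ suc (dbl m)
size-≤ (inj₁ refl) = n≤1+n _
size-≤ (inj₂ refl) = ≤-refl

size-≥ : ∀ {n m} → Size n m → dbl m ≤ n
size-≥ (inj₁ refl) = ≤-refl
size-≥ (inj₂ refl) = n≤1+n _

fun-perm-odd : ∀ {n m} (u : Vec (Fin n) n) → Size n m → IsPerm u → Perm (suc (dbl m)) (fun u)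
fun-perm-odd u (inj₂ refl) π = fun-perm π
fun-perm-odd {n} u (inj₁ refl) π = record { bound = bd ; inj = ij }
  where
  w = fun u
  P = fun-perm π
  wn : w n ≡ n
  wn = fun-≥ u ≤-refl
  bd : ∀ x → x < suc n → w x < suc n
  bd x x≤n with m≤n⇒m<n∨m≡n (s≤s⁻¹ x≤n)
  ... | inj₁ x<n  = m<n⇒m<1+n (bound P x x<n)
  ... | inj₂ refl = s≤s (≤-reflexive wn)
  ij : Inj< (suc n) w
  ij x y x≤n y≤n e with m≤n⇒m<n∨m≡n (s≤s⁻¹ x≤n) | m≤n⇒m<n∨m≡n (s≤s⁻¹ y≤n)
  ... | inj₁ x<n  | inj₁ y<n  = inj P x y x<n y<n e
  ... | inj₁ x<n  | inj₂ refl = contradiction (trans e wn) (<⇒≢ (bound P x x<n))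
  ... | inj₂ refl | inj₁ y<n  = contradiction (trans (sym e) wn) (<⇒≢ (bound P y y<n))
  ... | inj₂ refl | inj₂ refl = refl

ins : ℕ → ℕ → (ℕ → ℕ) → ℕ → ℕ
ins zero    N h zero    = N
ins zero    N h (suc x) = h x
ins (suc q) N h zero    = h 0
ins (suc q) N h (suc x) = ins q N (h ∘ suc) x

ins-at : ∀ q N h → ins q N h q ≡ N
ins-at zero    N h = refl
ins-at (suc q) N h = ins-at q N (h ∘ suc)

ins-skip : ∀ q N h x → ins q N h (skip q x) ≡ h x
ins-skip zero    N h x       = refl
ins-skip (suc q) N h zero    = refl
ins-skip (suc q) N h (suc x) = ins-skip q N (h ∘ suc) x

encode : ∀ {m} → Code m → ℕ → ℕ
encode {m} c = ins (dbl (p c)) (dbl m) (blow (τ c) (ε c))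

encode-encodes : ∀ {m} (c : Code m) → Encodes c (encode c)
encode-encodes {m} c = record
  { top  = ins-at (dbl (p c)) (dbl m) _
  ; rest = λ x _ → ins-skip (dbl (p c)) (dbl m) _ x }

encodes-cong : ∀ {m} {c : Code m} {w w′} → (∀ x → x < suc (dbl m) → w x ≡ w′ x) → Encodes c w → Encodes c w′
encodes-cong {m} {c} e enc = record
  { top  = trans (sym (e _ (s≤s (q≤2m enc)))) (top enc)
  ; rest = λ x x< → trans (sym (e _ (s≤s (≤-trans (skip-≤ (dbl (p c)) x) x<)))) (rest enc x x<) }

encodes-perm-n : ∀ {n m} {c : Code m} {w} → Fits n c → Encodes c w → Perm n w
encodes-perm-n (inj₂ refl) enc = encodes-perm enc
encodes-perm-n {m = m} {c = c} {w} (inj₁ (refl , p≡m)) enc = record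
  { bound = λ x x<n → subst (λ k → w k < dbl m) (skip-< (subst (λ k → x < dbl k) (sym p≡m) x<n)) (rest-< enc x x<n)
  ; inj   = λ x y x<n y<n → inj (encodes-perm enc) x y (m<n⇒m<1+n x<n) (m<n⇒m<1+n y<n) }

isEven-dbl : ∀ t → isEven (dbl t) ≡ true
isEven-dbl zero    = refl
isEven-dbl (suc t) = isEven-dbl t

isEven-sdbl : ∀ t → isEven (suc (dbl t)) ≡ false
isEven-sdbl zero    = refl
isEven-sdbl (suc t) = isEven-sdbl t

-- With letters counted from 0 the involution flips the last binary digit. Its fixed letter n, for
-- odd n, is excluded by the hypothesis, which is the restriction to [n - 1].
star-dig : ∀ n t e → suc (dig t e) < n → star n (suc (dig t e)) ≡ suc (dig t (not e))
star-dig n t true  lt rewrite isEven-dbl t = refl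
star-dig n t false lt rewrite isEven-sdbl t =
  cong (if_then suc (suc (dbl t)) else n) (dec-true (suc (suc (dbl t)) ≤? n) lt)

-- Since n has an even number of letters in front of it, it never separates the two letters of a
-- block.
skip-pair : ∀ p a → ∃ λ s → skip (dbl p) (dbl a) ≡ s × skip (dbl p) (suc (dbl a)) ≡ suc s
skip-pair zero    a       = suc (dbl a) , refl , refl
skip-pair (suc p) zero    = 0 , refl , refl
skip-pair (suc p) (suc a) with skip-pair p a
... | s , e , f = suc (suc s) , cong (suc ∘ suc) e , cong (suc ∘ suc) f

∣n-1+n∣≤1 : ∀ n → ∣ n - suc n ∣ ≤ 1
∣n-1+n∣≤1 zero    = ≤-refl
∣n-1+n∣≤1 (suc n) = ∣n-1+n∣≤1 n

∣1+n-n∣≤1 : ∀ n → ∣ suc n - n ∣ ≤ 1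
∣1+n-n∣≤1 zero    = ≤-refl
∣1+n-n∣≤1 (suc n) = ∣1+n-n∣≤1 n

encodes-isWachs : ∀ {n m} {c : Code m} (u : Vec (Fin n) n) → Fits n c → Encodes c (fun u) → IsWachs u
encodes-isWachs {n} {m} {c} u fits enc j k j-low k-star with unskip (dbl (p c)) (toℕ j)
... | inj₁ j≡q = contradiction j-low (<⇒≱ (≤-trans (s≤s (size-≤ (fits-size {c = c} fits)))
        (≤-reflexive (cong (suc ∘ suc) (sym (trans (sym (fun-toℕ u j)) (trans (cong (fun u) j≡q) (top enc))))))))
... | inj₂ (x , j≡) = near (evenOrOdd x)
  where
  w = fun u
  q = dbl (p c)
  N = suc (dbl m)
  n≤N : n ≤ N
  n≤N = size-≤ (fits-size {c = c} fits)
  x< : x < dbl m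
  x< = skip-<⁻ x (q≤2m enc) (subst (_< N) j≡ (<-≤-trans (toℕ<n j) n≤N))
  partner : ∀ t e y → y < dbl m → w (skip q x) ≡ dig t e → w (skip q y) ≡ dig t (not e) → toℕ k ≡ skip q y
  partner t e y y< ex ey = inj (encodes-perm enc) (toℕ k) (skip q y)
    (<-≤-trans (toℕ<n k) n≤N) (s≤s (≤-trans (skip-≤ q y) y<)) (suc-injective (begin
      suc (w (toℕ k))                 ≡⟨ cong suc (fun-toℕ u k) ⟩
      suc (toℕ (lookup u k))          ≡⟨ k-star ⟩
      star n (suc (toℕ (lookup u j))) ≡⟨ cong (star n ∘ suc) uj ⟩
      star n (suc (dig t e))          ≡⟨ star-dig n t e (subst (λ z → suc z < n) uj j-low) ⟩
      suc (dig t (not e))             ≡⟨ cong suc (sym ey) ⟩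
      suc (w (skip q y))              ∎))
    where
    open ≡-Reasoning
    uj : toℕ (lookup u j) ≡ dig t e
    uj = trans (sym (fun-toℕ u j)) (trans (cong w j≡) ex)
  near : (∃ λ a → x ≡ dbl a) ⊎ (∃ λ a → x ≡ suc (dbl a)) → ∣ toℕ j - toℕ k ∣ ≤ 1
  near (inj₁ (a , refl)) with skip-pair (p c) a
  ... | s , e , f = subst₂ (λ y z → ∣ y - z ∣ ≤ 1)
    (sym (trans j≡ e))
    (sym (trans (partner (τ c a) (ε c a) (suc (dbl a)) y<
      (trans (rest enc _ x<) (blow-even (τ c) (ε c) a)) (trans (rest enc _ y<) (blow-odd (τ c) (ε c) a))) f))
    (∣n-1+n∣≤1 s)
    where
    y< : suc (dbl a) < dbl m
    y< = dbl-mono (dbl-cancel-< x<)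
  near (inj₂ (a , refl)) with skip-pair (p c) a
  ... | s , e , f = subst₂ (λ y z → ∣ y - z ∣ ≤ 1)
    (sym (trans j≡ f))
    (sym (trans (partner (τ c a) (not (ε c a)) (dbl a) (<⇒≤ x<)
      (trans (rest enc _ x<) (blow-odd (τ c) (ε c) a))
      (trans (rest enc _ (<⇒≤ x<)) (trans (blow-even (τ c) (ε c) a) (cong (dig (τ c a)) (sym (not-involutive (ε c a))))))) e))
    (∣1+n-n∣≤1 s)

word : ∀ {n m} (c : Code m) → Fits n c → Σ (W n) λ u → Encodes c (fun (proj₁ u))
word {n} {m} c fits = (vec , fun-isPerm (Perm-cong (λ x x<n → sym (fun-toVec n w bd x x<n)) P)
                         , encodes-isWachs vec fits enc) , enc
  where
  w = encode c
  P : Perm n w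
  P = encodes-perm-n fits (encode-encodes c)
  bd = bound P
  vec = toVec n w bd
  same : Fits n c → ∀ x → x < suc (dbl m) → w x ≡ fun vec x
  same fits x x<N with <-≤-connex x n
  ... | inj₁ x<n = sym (fun-toVec n w bd x x<n)
  same (inj₂ refl) x x<N | inj₂ n≤x = contradiction n≤x (<⇒≱ x<N)
  same (inj₁ (refl , p≡m)) x x<N | inj₂ n≤x with ≤-antisym (s≤s⁻¹ x<N) n≤x
  ... | refl = trans (subst (λ k → w (dbl k) ≡ dbl m) p≡m (top (encode-encodes c))) (sym (fun-≥ vec ≤-refl))
  enc : Encodes c (fun vec)
  enc = encodes-cong (same fits) (encode-encodes c)

∣-∣≤1 : ∀ x y → ∣ x - y ∣ ≤ 1 → x ≡ y ⊎ y ≡ suc x ⊎ x ≡ suc y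
∣-∣≤1 zero          zero          _ = inj₁ refl
∣-∣≤1 zero          (suc zero)    _ = inj₂ (inj₁ refl)
∣-∣≤1 (suc zero)    zero          _ = inj₂ (inj₂ refl)
∣-∣≤1 zero          (suc (suc y)) (s≤s ())
∣-∣≤1 (suc (suc x)) zero          (s≤s ())
∣-∣≤1 (suc x)       (suc y)       h with ∣-∣≤1 x y h
... | inj₁ e        = inj₁ (cong suc e)
... | inj₂ (inj₁ e) = inj₂ (inj₁ (cong suc e))
... | inj₂ (inj₂ e) = inj₂ (inj₂ (cong suc e))

skip-≥x : ∀ q x → x ≤ skip q x
skip-≥x zero    x       = n≤1+n x
skip-≥x (suc q) zero    = z≤n
skip-≥x (suc q) (suc x) = s≤s (skip-≥x q x)

skip-∣-∣ : ∀ q x y → ∣ x - y ∣ ≤ ∣ skip q x - skip q y ∣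
skip-∣-∣ zero    x       y       = ≤-refl
skip-∣-∣ (suc q) zero    zero    = z≤n
skip-∣-∣ (suc q) zero    (suc y) = s≤s (skip-≥x q y)
skip-∣-∣ (suc q) (suc x) zero    = s≤s (skip-≥x q x)
skip-∣-∣ (suc q) (suc x) (suc y) = skip-∣-∣ q x y

dig-<⁻ : ∀ {t m} e → dig t e < dbl m → t < m
dig-<⁻ false p = dbl-cancel-< p
dig-<⁻ true  p = dbl-cancel-< (<⇒≤ p)

dbl≢sdbl : ∀ a b → dbl a ≢ suc (dbl b)
dbl≢sdbl a b e with dig-injective a b false true e
... | _ , ()

-- Once the largest letter is removed, partners stay adjacent, and an induction
-- from the left shows that they occupy positions 2a and 2a+1.
module Decode {n m : ℕ} (u : Vec (Fin n) n) (size : Size n m) (πu : IsPerm u) (wachs : IsWachs u) where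

  N = suc (dbl m)
  w = fun u

  πw : Perm N w
  πw = fun-perm-odd u size πu

  -- For n = 2m the Wachs condition is not imposed on the letter n, the larger one of its block. The
  -- smaller letter of a block is always in [n - 1], so the condition is applied to that one.
  adjacent-low : ∀ t j k → t < m → w j ≡ dbl t → w k ≡ suc (dbl t) → ∣ j - k ∣ ≤ 1
  adjacent-low t j k t<m ej ek = subst₂ (λ y z → ∣ y - z ∣ ≤ 1) (toℕ-fromℕ< j<n) (toℕ-fromℕ< k<n)
    (wachs (fromℕ< j<n) (fromℕ< k<n)
      (subst (λ z → suc z < n) (sym uj) t<n)
      (trans (cong suc (trans (sym (fun-< u k<n)) ek)) (sym (trans (cong (star n ∘ suc) uj) (star-dig n t false t<n)))))
    where
    t<n : suc (dbl t) < n
    t<n = ≤-trans (dbl-mono t<m) (size-≥ size)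
    inside : ∀ x → w x < dbl m → x < n
    inside x lt with <-≤-connex x n
    ... | inj₁ p = p
    ... | inj₂ p = contradiction (≤-trans (size-≥ size) (≤-trans p (≤-reflexive (sym (fun-≥ u p))))) (<⇒≱ lt)
    j<n : j < n
    j<n = inside j (subst (_< dbl m) (sym ej) (dig-< false t<m))
    k<n : k < n
    k<n = inside k (subst (_< dbl m) (sym ek) (dig-< true t<m))
    uj : toℕ (lookup u (fromℕ< j<n)) ≡ dbl t
    uj = trans (sym (fun-< u j<n)) ej

  adjacent : ∀ t e j k → t < m → w j ≡ dig t e → w k ≡ dig t (not e) → ∣ j - k ∣ ≤ 1
  adjacent t false j k t<m ej ek = adjacent-low t j k t<m ej ek
  adjacent t true  j k t<m ej ek = subst (_≤ 1) (∣-∣-comm k j) (adjacent-low t k j t<m ek ej)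

  topPos : ∃ λ q → q < N × w q ≡ dbl m
  topPos = surjective πw (dbl m) ≤-refl

  q : ℕ
  q = proj₁ topPos

  q≤ : q ≤ dbl m
  q≤ = s≤s⁻¹ (proj₁ (proj₂ topPos))

  wq : w q ≡ dbl m
  wq = proj₂ (proj₂ topPos)

  h : ℕ → ℕ
  h = w ∘ skip q

  skip<N : ∀ x → x < dbl m → skip q x < N
  skip<N x x< = s≤s (≤-trans (skip-≤ q x) x<)

  πh : Perm (dbl m) h
  πh = record
    { bound = λ x x< → ≤∧≢⇒< (s≤s⁻¹ (bound πw _ (skip<N x x<)))
        (λ e → skip-≢ q x (inj πw _ q (skip<N x x<) (s≤s q≤) (trans e (sym wq))))
    ; inj   = λ x y x< y< e → skip-injective q x y (inj πw _ _ (skip<N x x<) (skip<N y y<) e) }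

  pairs : ∀ a t e → a < m → h (dbl a) ≡ dig t e → h (suc (dbl a)) ≡ dig t (not e)
  pairs a t e a<m ea = go k≡
    where
    A<m : dbl a < dbl m
    A<m = dig-< false a<m
    t<m : t < m
    t<m = dig-<⁻ e (subst (_< dbl m) ea (bound πh (dbl a) A<m))
    found = surjective πh (dig t (not e)) (dig-< (not e) t<m)
    k = proj₁ found
    ek : h k ≡ dig t (not e)
    ek = proj₂ (proj₂ found)
    k≡ : dbl a ≡ k ⊎ k ≡ suc (dbl a) ⊎ dbl a ≡ suc k
    k≡ = ∣-∣≤1 (dbl a) k (≤-trans (skip-∣-∣ q (dbl a) k) (adjacent t e _ _ t<m ea ek))
    -- A partner at position 2a - 1 would by induction also be the partner of the letter at 2a - 2.
    -- Then the letters at 2a - 2 and 2a would coincide.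
    previous : ∀ a → a < m → h (dbl a) ≡ dig t e → dbl a ≡ suc k → ⊥
    previous (suc a) a<m ea eq with dig-view (h (dbl a))
    ... | t′ , e′ , ea′ with dig-injective _ _ (not e′) (not e)
            (trans (sym (pairs a t′ e′ (<⇒≤ a<m) ea′)) (trans (cong h (suc-injective eq)) ek))
    ...   | refl , ne≡ = <⇒≢ (≤-trans (n≤1+n _) ≤-refl) (inj πh (dbl a) (dbl (suc a)) (dig-< false (<⇒≤ a<m)) (dig-< false a<m)
              (trans ea′ (trans (cong (dig t) (trans (sym (not-involutive e′)) (trans (cong not ne≡) (not-involutive e)))) (sym ea))))
    go : dbl a ≡ k ⊎ k ≡ suc (dbl a) ⊎ dbl a ≡ suc k → h (suc (dbl a)) ≡ dig t (not e)
    go (inj₁ eq) = contradiction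
      (proj₂ (dig-injective _ _ e (not e) (trans (sym ea) (trans (cong h eq) ek)))) (b≢not-b e)
    go (inj₂ (inj₁ eq)) = trans (cong h (sym eq)) ek
    go (inj₂ (inj₂ eq)) = ⊥-elim (previous a a<m ea eq)

  -- At an odd position n would stand between the two letters of a block and put them at distance 2.
  q-even : ∃ λ p → q ≡ dbl p
  q-even with evenOrOdd q
  ... | inj₁ r       = r
  ... | inj₂ (a , eq) with dig-view (h (dbl a))
  ...   | t , e , ea = contradiction
    (subst₂ (λ y z → ∣ y - z ∣ ≤ 1) (skip-< (≤-reflexive (sym eq))) (skip-≥ (≤-reflexive eq))
      (adjacent t e _ _ (dig-<⁻ e (subst (_< dbl m) ea (bound πh (dbl a) (dig-< false a<m)))) ea (pairs a t e a<m ea)))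
    (far (dbl a))
    where
    a<m : a < m
    a<m = dbl-cancel-< (subst (_≤ dbl m) eq q≤)
    far : ∀ x → ¬ ∣ x - suc (suc x) ∣ ≤ 1
    far zero    (s≤s ())
    far (suc x) le = far x le

  block : ℕ → ℕ
  block a = proj₁ (dig-view (h (dbl a)))

  reversed : ℕ → Bool
  reversed a = proj₁ (proj₂ (dig-view (h (dbl a))))

  h-even : ∀ a → h (dbl a) ≡ dig (block a) (reversed a)
  h-even a = proj₂ (proj₂ (dig-view (h (dbl a))))

  h-odd : ∀ a → a < m → h (suc (dbl a)) ≡ dig (block a) (not (reversed a))
  h-odd a a<m = pairs a (block a) (reversed a) a<m (h-even a)

  block-perm : Perm m block
  block-perm = record
    { bound = λ a a<m → dig-<⁻ (reversed a) (subst (_< dbl m) (h-even a) (bound πh (dbl a) (dig-< false a<m)))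
    ; inj   = ij }
    where
    ij : Inj< m block
    ij a b a<m b<m e with reversed a Bool.≟ reversed b
    ... | yes r = proj₁ (dig-injective a b false false (inj πh (dbl a) (dbl b) (dig-< false a<m) (dig-< false b<m)
            (trans (h-even a) (trans (cong₂ dig e r) (sym (h-even b))))))
    -- With different bits, the first letter of block a would be the second letter of block b, at a
    -- position of other parity.
    ... | no ¬r = contradiction (inj πh (dbl a) (suc (dbl b)) (dig-< false a<m) (dig-< true b<m)
            (trans (h-even a) (trans (cong₂ dig e (other (reversed a) (reversed b) ¬r)) (sym (h-odd b b<m)))))
            (dbl≢sdbl a b)
      where
      other : ∀ x y → x ≢ y → x ≡ not y
      other false false ne = contradiction refl ne
      other false true  ne = refl
      other true  false ne = refl
      other true  true  ne = contradiction refl ne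

  decoded : Code m
  decoded = record
    { τ = block ; ε = reversed ; p = proj₁ q-even
    ; p≤m = dbl-cancel-≤ (subst (_≤ dbl m) (proj₂ q-even) q≤) ; perm = block-perm }

  decoded-encodes : Encodes decoded w
  decoded-encodes = record
    { top  = trans (cong w (sym (proj₂ q-even))) wq
    ; rest = λ x x< → trans (cong (λ r → w (skip r x)) (sym (proj₂ q-even))) (agree x x<) }
    where
    agree : ∀ x → x < dbl m → h x ≡ blow block reversed x
    agree x x< with evenOrOdd x
    ... | inj₁ (a , refl) = trans (h-even a) (sym (blow-even block reversed a))
    ... | inj₂ (a , refl) = trans (h-odd a (dbl-cancel-< (<⇒≤ x<))) (sym (blow-odd block reversed a))

  decoded-fits : Fits n decoded
  decoded-fits = go size
    where
    go : Size n m → Fits n decoded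
    go (inj₂ e) = inj₂ e
    go (inj₁ e) = inj₁ (e , proj₁ (dig-injective _ _ false false (trans (sym (proj₂ q-even)) q≡)))
      where
      q≡ : q ≡ dbl m
      -- For n = 2m the extended word fixes 2m, so the added letter stands last and all blocks
      -- precede it.
      q≡ = inj πw q (dbl m) (s≤s q≤) ≤-refl (trans wq (sym (fun-≥ u (≤-reflexive e))))

-- Reading off f_n and ℓ_W from a code

applyUpTo-cong : ∀ {f g : ℕ → ℕ} k → (∀ x → x < k → f x ≡ g x) → applyUpTo f k ≡ applyUpTo g k
applyUpTo-cong zero    e = refl
applyUpTo-cong (suc k) e = cong₂ _∷_ (e 0 (s≤s z≤n)) (applyUpTo-cong k (λ x p → e (suc x) (s≤s p)))

filter-≢-all : ∀ N w k → (∀ x → x < k → w x ≢ N) → filter (λ x → ¬? (x ≟ N)) (applyUpTo w k) ≡ applyUpTo w k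
filter-≢-all N w zero    h = refl
filter-≢-all N w (suc k) h = trans (filter-accept (λ x → ¬? (x ≟ N)) (h 0 (s≤s z≤n)))
  (cong (w 0 ∷_) (filter-≢-all N (w ∘ suc) k (λ x p → h (suc x) (s≤s p))))

filter-≢-skip : ∀ N w q k → q ≤ k → w q ≡ N → (∀ x → x < k → w (skip q x) ≢ N) →
  filter (λ x → ¬? (x ≟ N)) (applyUpTo w (suc k)) ≡ applyUpTo (w ∘ skip q) k
filter-≢-skip N w zero k q≤k wq h = trans (filter-reject (λ x → ¬? (x ≟ N)) (λ ne → ne wq))
  (filter-≢-all N (w ∘ suc) k h)
filter-≢-skip N w (suc q) (suc k) (s≤s q≤k) wq h = trans (filter-accept (λ x → ¬? (x ≟ N)) (h 0 (s≤s z≤n)))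
  (cong (w 0 ∷_) (filter-≢-skip N (w ∘ suc) q k q≤k wq (λ x p → h (suc x) (s≤s p))))

⌈dig/2⌉ : ∀ t e → ⌈ suc (dig t e) /2⌉ ≡ suc t
⌈dig/2⌉ zero    false = refl
⌈dig/2⌉ zero    true  = refl
⌈dig/2⌉ (suc t) false = cong suc (⌈dig/2⌉ t false)
⌈dig/2⌉ (suc t) true  = cong suc (⌈dig/2⌉ t true)

pairBlocks-blow : ∀ τ ε m → pairBlocks (applyUpTo (suc ∘ blow τ ε) (dbl m)) ≡ applyUpTo (suc ∘ τ) m
pairBlocks-blow τ ε zero    = refl
pairBlocks-blow τ ε (suc m) = cong₂ _∷_ (⌈dig/2⌉ (τ 0) (ε 0)) (pairBlocks-blow (τ ∘ suc) (ε ∘ suc) m)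

chi-even : ∀ m xs → chi (dbl m) xs ≡ xs
chi-even m xs rewrite isEven-dbl m = refl

chi-odd : ∀ m xs → chi (suc (dbl m)) xs ≡ filter (λ x → ¬? (x ≟ suc (dbl m))) xs
chi-odd m xs rewrite isEven-sdbl m = refl

fW-encoded : ∀ {n m} {c : Code m} (u : Vec (Fin n) n) → Fits n c → Encodes c (fun u) →
  fW u ≡ applyUpTo (suc ∘ τ c) m
fW-encoded {m = m} {c = c} u fits enc = trans (cong pairBlocks (blocks fits)) (pairBlocks-blow (τ c) (ε c) m)
  where
  blocks : Fits _ c → chi _ (vals u) ≡ applyUpTo (suc ∘ blow (τ c) (ε c)) (dbl m)
  blocks (inj₁ (refl , p≡m)) = trans (chi-even m (vals u)) (trans (vals-fun u)
    (applyUpTo-cong (dbl m) λ x x< → cong suc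
      (trans (cong (fun u) (sym (skip-< (subst (λ k → x < dbl k) (sym p≡m) x<)))) (rest enc x x<))))
  blocks (inj₂ refl) = begin
    chi N (vals u)                                          ≡⟨ chi-odd m (vals u) ⟩
    filter (λ x → ¬? (x ≟ N)) (vals u)                      ≡⟨ cong (filter (λ x → ¬? (x ≟ N))) (vals-fun u) ⟩
    filter (λ x → ¬? (x ≟ N)) (applyUpTo (suc ∘ fun u) N)   ≡⟨ filter-≢-skip N (suc ∘ fun u) (dbl (p c)) (dbl m) (q≤2m enc)
                                                                 (cong suc (top enc))
                                                                 (λ x x< e → <⇒≢ (rest-< enc x x<) (suc-injective e)) ⟩
    applyUpTo (suc ∘ fun u ∘ skip (dbl (p c))) (dbl m)      ≡⟨ applyUpTo-cong (dbl m) (λ x x< → cong suc (rest enc x x<)) ⟩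
    applyUpTo (suc ∘ blow (τ c) (ε c)) (dbl m)              ∎
    where
    open ≡-Reasoning
    N = suc (dbl m)

len-odd : ∀ {n m} (u : Vec (Fin n) n) → Size n m → IsPerm u → len u ≡ inv (fun u) (suc (dbl m))
len-odd u (inj₂ refl) π = len-inv u
len-odd {n} u (inj₁ refl) π = trans (len-inv u) (sym (trans
  (cong (inv (fun u) n +_) (gt-≡0 (fun u) n (fun u n) (λ x x<n →
    ≤-trans (<⇒≤ (bound (fun-perm π) x x<n)) (≤-reflexive (sym (fun-≥ u ≤-refl))))))
  (+-identityʳ _)))

dbl-∸ : ∀ m p → dbl m ∸ dbl p ≡ 2 * (m ∸ p)
dbl-∸ m       zero    = trans (dbl-+ m) (cong (m +_) (sym (+-identityʳ m)))
dbl-∸ zero    (suc p) = refl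
dbl-∸ (suc m) (suc p) = dbl-∸ m p

-- f_n recovers τ, so one of the four inversions per inversion of τ is subtracted; this is the
-- origin of the factor 3 in `wlen`. Since inv τ occurs four times in the length, the subtraction
-- does not truncate.
lenW-encoded : ∀ {n m} {c : Code m} (u : W n) → Fits n c → Encodes c (fun (proj₁ u)) → lenW u ≡ wlen c
lenW-encoded {n} {m} {c} (u , π , wachs) fits enc = begin
  len u ∸ invs (fW u)                            ≡⟨ cong₂ _∸_ (trans (len-odd u (fits-size {c = c} fits) π) (inv-encoded enc)) invs≡ ⟩
  4 * I + T + (dbl m ∸ dbl (p c)) ∸ I            ≡⟨ cong (λ k → 4 * I + T + k ∸ I) (dbl-∸ m (p c)) ⟩
  4 * I + T + 2 * Q ∸ I                          ≡⟨ cong (_∸ I) (lem I T Q) ⟩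
  I + (3 * I + T + 2 * Q) ∸ I                    ≡⟨ m+n∸m≡n I _ ⟩
  3 * I + T + 2 * Q                              ∎
  where
  open ≡-Reasoning
  I = inv (τ c) m
  T = tot (ε c) m
  Q = m ∸ p c
  invs≡ : invs (fW u) ≡ I
  invs≡ = trans (cong invs (fW-encoded {c = c} u fits enc)) (trans (invs-applyUpTo (suc ∘ τ c) m) (inv-suc (τ c) m))
  lem : ∀ i t q → 4 * i + t + 2 * q ≡ i + (3 * i + t + 2 * q)
  lem = solve-∀

-- The least and the greatest code

minCode : ∀ m → Code m
minCode m = record { τ = λ x → x ; ε = λ _ → false ; p = m ; p≤m = ≤-refl
                   ; perm = record { bound = λ x x<m → x<m ; inj = λ x y _ _ e → e } }

min-⊑ : ∀ {m} (c : Code m) → minCode m ⊑ c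
min-⊑ {m} c = record { dom = d ; p≥ = p≤m c ; stuck = λ _ _ _ _ → inj₁ z≤n }
  where
  d : Dom m (λ x → x) (τ c)
  d a b a≤m b≤m with ≤-total a b
  ... | inj₁ a≤b = ≤-trans (cnt≤ (τ c) a b) (≤-reflexive (sym (cnt-full _ a b (λ x x<a → <-≤-trans x<a a≤b))))
  ... | inj₂ b≤a = ≤-trans (cnt≤ʳ (τ c) a b a≤m (inj (perm c)))
    (≤-trans (≤-reflexive (sym (cnt-full _ b b (λ x x<b → x<b)))) (cnt-mono (λ x → x) b b≤a))

maxCode : ∀ m p → p ≤ m → Code m
maxCode m p p≤m = record { τ = λ x → m ∸ suc x ; ε = λ _ → true ; p = p ; p≤m = p≤m
  ; perm = record { bound = λ x x<m → ∸-monoʳ-< {m} {suc x} {0} (s≤s z≤n) x<m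
                  ; inj = λ x y x<m y<m e → suc-injective (∸-cancelˡ-≡ x<m y<m e) } }

-- The least count possible for any permutation: of a letters at most m - b can avoid the b smallest
-- values. `⊑-max` compares with this bound.
cnt-reverse : ∀ m a b → a ≤ m → b ≤ m → cnt (λ x → m ∸ suc x) a b ≡ a + b ∸ m
cnt-reverse m zero    b a≤m b≤m = sym (m≤n⇒m∸n≡0 b≤m)
cnt-reverse m (suc a) b a<m b≤m with <-≤-connex (a + b) m
... | inj₁ lt = trans (cong₂ _+_ (trans (cnt-reverse m a b (<⇒≤ a<m) b≤m) (m≤n⇒m∸n≡0 (<⇒≤ lt)))
                        (ind-≥ (m+n≤o⇒m≤o∸n b (subst (_≤ m) (trans (cong suc (+-comm a b)) (sym (+-suc b a))) lt))))
                  (sym (m≤n⇒m∸n≡0 lt))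
... | inj₂ ge = trans (cong₂ _+_ (cnt-reverse m a b (<⇒≤ a<m) b≤m) (ind-< (below-b b ge)))
                  (trans (+-comm _ 1) (sym (+-∸-assoc 1 ge)))
  where
  below-b : ∀ b → m ≤ a + b → m ∸ suc a < b
  below-b zero    ge = contradiction (subst (m ≤_) (+-identityʳ a) ge) (<⇒≱ a<m)
  below-b (suc b) ge = s≤s (m≤n+o⇒m∸n≤o m (suc a) (subst (m ≤_) (+-suc a b) ge))

⊑-max : ∀ {m} (c : Code m) p (p≤m : p ≤ m) → p ≤ Code.p c → c ⊑ maxCode m p p≤m
⊑-max {m} c p p≤m p≤ = record { dom = d ; p≥ = p≤ ; stuck = λ a _ _ _ → inj₁ (χ≤1 (ε c a)) }
  where
  d : Dom m (τ c) (λ x → m ∸ suc x)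
  d a b a≤m b≤m = begin
    cnt (λ x → m ∸ suc x) a b ≡⟨ cnt-reverse m a b a≤m b≤m ⟩
    a + b ∸ m                 ≤⟨ m≤n+o⇒m∸n≤o (a + b) m a+b≤ ⟩
    cnt (τ c) a b             ∎
    where
    open ≤-Reasoning
    lem : ∀ x y z → (x + y) + z ≡ (x + z) + y
    lem = solve-∀
    a+b≤ : a + b ≤ m + cnt (τ c) a b
    a+b≤ = begin
      a + b                              ≡⟨ cong (_+ b) (sym (cnt-full (τ c) a m (λ x x<a → bound (perm c) x (<-≤-trans x<a a≤m)))) ⟩
      cnt (τ c) a m + b                  ≡⟨ cong (λ k → cnt (τ c) a k + b) (sym (m∸n+n≡m b≤m)) ⟩
      cnt (τ c) a (m ∸ b + b) + b        ≤⟨ +-monoˡ-≤ b (cnt-+≤ (τ c) a b (m ∸ b) a≤m (inj (perm c))) ⟩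
      (m ∸ b) + cnt (τ c) a b + b        ≡⟨ lem (m ∸ b) _ b ⟩
      (m ∸ b) + b + cnt (τ c) a b        ≡⟨ cong (_+ cnt (τ c) a b) (m∸n+n≡m b≤m) ⟩
      m + cnt (τ c) a b                  ∎

inv-id : ∀ a → inv (λ x → x) a ≡ 0
inv-id zero    = refl
inv-id (suc a) = cong₂ _+_ (inv-id a) (gt-≡0 (λ x → x) a a (λ _ → <⇒≤))

tot-false : ∀ a → tot (λ _ → false) a ≡ 0
tot-false zero    = refl
tot-false (suc a) = trans (+-identityʳ _) (tot-false a)

wlen-min : ∀ m → wlen (minCode m) ≡ 0
wlen-min m rewrite inv-id m | tot-false m | n∸n≡0 m = refl

tot-true : ∀ a → tot (λ _ → true) a ≡ a
tot-true zero    = refl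
tot-true (suc a) = trans (+-comm _ 1) (cong suc (tot-true a))

sucC2 : ∀ a → suc a C 2 ≡ a + a C 2
sucC2 a = trans (sym (nCk+nC[k+1]≡[n+1]C[k+1] a 1)) (cong (_+ a C 2) (nC1≡n a))

gt-full : ∀ w a b → (∀ x → x < a → b < w x) → gt w a b ≡ a
gt-full w zero    b h = refl
gt-full w (suc a) b h = trans
  (cong₂ _+_ (gt-full w a b (λ x p → h x (m<n⇒m<1+n p))) (ind-< (h a ≤-refl)))
  (+-comm a 1)

inv-reverse : ∀ m a → a ≤ m → inv (λ x → m ∸ suc x) a ≡ a C 2
inv-reverse m zero    a≤m = refl
inv-reverse m (suc a) a<m = trans
  (cong₂ _+_ (inv-reverse m a (<⇒≤ a<m)) (gt-full _ a (m ∸ suc a) (λ x x<a → ∸-monoʳ-< (s≤s x<a) a<m)))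
  (trans (+-comm (a C 2) a) (sym (sucC2 a)))

-- Pairs among 2m letters: four for every pair of blocks and one inside each block.
dblC2 : ∀ m → dbl m C 2 ≡ 4 * (m C 2) + m
dblC2 zero    = refl
dblC2 (suc m) = begin
  dbl (suc m) C 2                        ≡⟨ sucC2 (suc (dbl m)) ⟩
  suc (dbl m) + suc (dbl m) C 2          ≡⟨ cong (suc (dbl m) +_) (sucC2 (dbl m)) ⟩
  suc (dbl m) + (dbl m + dbl m C 2)      ≡⟨ cong₂ (λ d k → suc d + (d + k)) (dbl-+ m) (dblC2 m) ⟩
  suc (m + m) + (m + m + (4 * (m C 2) + m)) ≡⟨ lem m (m C 2) ⟩
  4 * (m + m C 2) + suc m                ≡⟨ cong (λ k → 4 * k + suc m) (sym (sucC2 m)) ⟩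
  4 * (suc m C 2) + suc m                ∎
  where
  open ≡-Reasoning
  lem : ∀ m k → suc (m + m) + (m + m + (4 * k + m)) ≡ 4 * (m + k) + suc m
  lem = solve-∀

wlen-max : ∀ m p p≤m → wlen (maxCode m p p≤m) ≡ 3 * (m C 2) + m + 2 * (m ∸ p)
wlen-max m p p≤m = cong₂ (λ i t → 3 * i + t + 2 * (m ∸ p)) (inv-reverse m m ≤-refl) (tot-true m)

⌊dbl/2⌋ : ∀ m → ⌊ dbl m /2⌋ ≡ m
⌊dbl/2⌋ zero    = refl
⌊dbl/2⌋ (suc m) = cong suc (⌊dbl/2⌋ m)

⌊sdbl/2⌋ : ∀ m → ⌊ suc (dbl m) /2⌋ ≡ m
⌊sdbl/2⌋ zero    = refl
⌊sdbl/2⌋ (suc m) = cong suc (⌊sdbl/2⌋ m)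

-- For n = 2m the value p = m is forced. For odd n the letter n moves to the front, p = 0, and its
-- 2m inversions account for the passage from 2m to 2m + 1 letters in the binomial coefficient.
topCode : ∀ {n m} → Size n m → Σ (Code m) λ t → Fits n t × (∀ c → Fits n c → c ⊑ t) × wlen t ≡ n C 2 ∸ (⌊ n /2⌋ C 2)
topCode {n} {m} (inj₁ refl) = maxCode m m ≤-refl , inj₁ (refl , refl) , above , (begin
  wlen (maxCode m m ≤-refl)      ≡⟨ wlen-max m m ≤-refl ⟩
  3 * K + m + 2 * (m ∸ m)        ≡⟨ cong (λ k → 3 * K + m + 2 * k) (n∸n≡0 m) ⟩
  3 * K + m + 0                  ≡⟨ sym (m+n∸m≡n K _) ⟩
  K + (3 * K + m + 0) ∸ K        ≡⟨ cong (_∸ K) (lem K m) ⟩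
  4 * K + m ∸ K                  ≡⟨ cong₂ (λ x y → x ∸ y C 2) (sym (dblC2 m)) (sym (⌊dbl/2⌋ m)) ⟩
  dbl m C 2 ∸ (⌊ dbl m /2⌋ C 2)  ∎)
  where
  open ≡-Reasoning
  K = m C 2
  lem : ∀ k m → k + (3 * k + m + 0) ≡ 4 * k + m
  lem = solve-∀
  above : ∀ c → Fits (dbl m) c → c ⊑ maxCode m m ≤-refl
  above c (inj₁ (_ , p≡m)) = ⊑-max c m ≤-refl (≤-reflexive (sym p≡m))
  above c (inj₂ e) = contradiction e (dbl≢sdbl m m)
topCode {n} {m} (inj₂ refl) = maxCode m 0 z≤n , inj₂ refl , (λ c _ → ⊑-max c 0 z≤n z≤n) , (begin
  wlen (maxCode m 0 z≤n)         ≡⟨ wlen-max m 0 z≤n ⟩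
  3 * K + m + 2 * m              ≡⟨ sym (m+n∸m≡n K _) ⟩
  K + (3 * K + m + 2 * m) ∸ K    ≡⟨ cong (_∸ K) (lem K m) ⟩
  (m + m) + (4 * K + m) ∸ K      ≡⟨ cong₂ (λ x y → x + y ∸ K) (sym (dbl-+ m)) (sym (dblC2 m)) ⟩
  dbl m + dbl m C 2 ∸ K          ≡⟨ cong₂ (λ x y → x ∸ y C 2) (sym (sucC2 (dbl m))) (sym (⌊sdbl/2⌋ m)) ⟩
  suc (dbl m) C 2 ∸ (⌊ suc (dbl m) /2⌋ C 2)  ∎)
  where
  open ≡-Reasoning
  K = m C 2
  lem : ∀ k m → k + (3 * k + m + 2 * m) ≡ (m + m) + (4 * k + m)
  lem = solve-∀

-- Gradedness

size? : ∀ n → ∃ λ m → Size n m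
size? n with evenOrOdd n
... | inj₁ (m , e) = m , inj₁ e
... | inj₂ (m , e) = m , inj₂ e

module _ {n m : ℕ} (size : Size n m) where

  open Graded (_<W_ {n})

  decode : (u : W n) → Σ (Code m) λ c → Fits n c × Encodes c (fun (proj₁ u))
  decode (u , π , wachs) = decoded , decoded-fits , decoded-encodes
    where open Decode u size π wachs

  ⊑⇒≤W : ∀ {c c′ : Code m} {u v : W n} →
    Encodes c (fun (proj₁ u)) → Encodes c′ (fun (proj₁ v)) → c ⊑ c′ → u ≤W v
  ⊑⇒≤W {u = u} {v} eu ev le = Dom⇒Bruhat (proj₁ (proj₂ u)) (proj₁ (proj₂ v))
    (Dom-weaken {u = fun (proj₁ u)} {fun (proj₁ v)} (size-≤ size) (⊑⇒Dom eu ev le))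

  ≤W⇒⊑ : ∀ {c c′ : Code m} {u v : W n} →
    Encodes c (fun (proj₁ u)) → Encodes c′ (fun (proj₁ v)) → u ≤W v → c ⊑ c′
  ≤W⇒⊑ {u = u} eu ev le = Dom⇒⊑ eu ev (Bruhat⇒Dom (proj₁ (proj₂ u)) le (suc (dbl m)))

  lenW-cong : ∀ {u v : W n} → proj₁ u ≡ proj₁ v → lenW u ≡ lenW v
  lenW-cong = cong (λ w → len w ∸ invs (fW w))

  _≟W_ : (u v : W n) → Dec (proj₁ u ≡ proj₁ v)
  u ≟W v = ≡-dec Fin._≟_ (proj₁ u) (proj₁ v)

  fits-between : ∀ {c c′ : Code m} (b : Between c c′) → Fits n c → Fits n c′ → Fits n (Between.d b)
  fits-between b (inj₂ e) _ = inj₂ e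
  fits-between b (inj₁ (e , p≡m)) fits′ = inj₁ (e , go (Between.p-or b) fits′)
    where
    go : _ → _ → p (Between.d b) ≡ m
    go (inj₁ q) _ = trans q p≡m
    go (inj₂ q) (inj₁ (_ , p′≡m)) = contradiction q (<-irrefl (trans p′≡m (sym p≡m)))
    go (inj₂ q) (inj₂ e′) = contradiction (trans (sym e) e′) (dbl≢sdbl m m)

  -- The interpolated word is strictly above x, since its ℓ_W is larger by one, and is at most y. A
  -- cover leaves room only for y itself, which therefore has that value.
  cover-lenW : ∀ (x y : W n) → x ⋖ y → lenW y ≡ suc (lenW x)
  cover-lenW x y ((x≤y , x≢y) , nothing) with decode x | decode y
  ... | c , fc , ec | c′ , fc′ , ec′ with interpolate (≤W⇒⊑ {u = x} {y} ec ec′ x≤y)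
  ...   | inj₁ c≈c′ = contradiction
            (fun-injective (λ k k<n → encodes-unique (encodes-≈ c≈c′ ec) ec′ k (<-≤-trans k<n (size-≤ size)))) x≢y
  ...   | inj₂ b = conclude (z ≟W y)
    where
    open Between b
    fd : Fits n d
    fd = fits-between b fc fc′
    z : W n
    z = proj₁ (word d fd)
    ez : Encodes d (fun (proj₁ z))
    ez = proj₂ (word d fd)
    lz : lenW z ≡ suc (lenW x)
    lz = trans (lenW-encoded z fd ez) (trans wlen≡ (cong suc (sym (lenW-encoded x fc ec))))
    x<z : x <W z
    x<z = ⊑⇒≤W {u = x} {z} ec ez c⊑d , λ e → contradiction (trans (lenW-cong {x} {z} e) lz) (<⇒≢ ≤-refl)
    conclude : Dec (proj₁ z ≡ proj₁ y) → lenW y ≡ suc (lenW x)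
    conclude (yes e) = trans (sym (lenW-cong {z} {y} e)) lz
    conclude (no ne) = contradiction (z , x<z , ⊑⇒≤W {u = z} {y} ez ec′ d⊑c′ , ne) nothing

  -- A minimal element is the least one, as otherwise the word of `minCode` would lie strictly below
  -- it.
  minimal-lenW : ∀ (x : W n) → Minimal x → lenW x ≡ 0
  minimal-lenW x min = go (z ≟W x)
    where
    fits : Size n m → Fits n (minCode m)
    fits (inj₁ e) = inj₁ (e , refl)
    fits (inj₂ e) = inj₂ e
    zw = word (minCode m) (fits size)
    z = proj₁ zw
    cx = decode x
    go : Dec (proj₁ z ≡ proj₁ x) → lenW x ≡ 0
    go (yes e) = trans (sym (lenW-cong {z} {x} e)) (trans (lenW-encoded z (fits size) (proj₂ zw)) (wlen-min m))
    go (no ne) = contradiction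
      (z , ⊑⇒≤W {u = z} {x} (proj₂ zw) (proj₂ (proj₂ cx)) (min-⊑ (proj₁ cx)) , ne) min

  maximal-lenW : ∀ (x : W n) → Maximal x → lenW x ≡ n C 2 ∸ (⌊ n /2⌋ C 2)
  maximal-lenW x max with topCode size
  ... | t , ft , above , wt = go (x ≟W z)
    where
    zw = word t ft
    z = proj₁ zw
    cx = decode x
    go : Dec (proj₁ x ≡ proj₁ z) → lenW x ≡ n C 2 ∸ (⌊ n /2⌋ C 2)
    go (yes e) = trans (lenW-cong {x} {z} e) (trans (lenW-encoded z ft (proj₂ zw)) wt)
    go (no ne) = contradiction
      (z , ⊑⇒≤W {u = x} {z} (proj₂ (proj₂ cx)) (proj₂ zw) (above (proj₁ cx) (proj₁ (proj₂ cx))) , ne) max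

  chain-lenW : ∀ {x z k} → Chain x z k → lenW z ≡ k + lenW x
  chain-lenW (single x) = refl
  chain-lenW (step {x} {y} {k = k} x⋖y ch) =
    trans (chain-lenW ch) (trans (cong (k +_) (cover-lenW x y x⋖y)) (+-suc k (lenW x)))

theorem3p9 : (n : ℕ) → 0 Data.Nat.< n →
    Graded.GradedOfRank (_<W_ {n}) (n C 2 ∸ (⌊ n /2⌋ C 2))
    × Graded.IsRankFunction (_<W_ {n}) lenW
theorem3p9 n _ =
  (λ x z k ch min max → begin
    k                       ≡⟨ sym (+-identityʳ k) ⟩
    k + 0                   ≡⟨ cong (k +_) (sym (minimal-lenW size x min)) ⟩
    k + lenW x              ≡⟨ sym (chain-lenW size ch) ⟩
    lenW z                  ≡⟨ maximal-lenW size z max ⟩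
    n C 2 ∸ (⌊ n /2⌋ C 2)   ∎) ,
  minimal-lenW size , cover-lenW size
  where
  open ≡-Reasoning
  size = proj₂ (size? n)
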